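{- Let $B_1,B_2,\dots,B_m$ be a set of mutually unbiased bases in $\mathbb{C}^n$. Then there are $m$ classes $C_1,C_2,\dots,C_m$, each consisting of $n$ commuting normal matrices in $\mathcal{M}_n(\mathbb{C})$, such that the matrices in $C_1\cup C_2\cup\cdots\cup C_m$ are pairwise orthogonal.
   Context: $\mathcal{M}_n(\mathbb{C})$ is the set of $n\times n$ complex matrices, and $A^\dagger$ is the conjugate transpose of $A$. Two matrices $A,B\in\mathcal{M}_n(\mathbb{C})$ are orthogonal if $\mathrm{tr}(A^\dagger B)=0$; pairwise orthogonality of the matrices in a set means that any two distinct elements of the set are orthogonal. Two orthonormal bases $\{\mathbf{a}_1,\dots,\mathbf{a}_n\}$ and $\{\mathbf{b}_1,\dots,\mathbf{b}_n\}$ of $\mathbb{C}^n$ are mutually unbiased if $|\langle \mathbf{a}_i,\mathbf{b}_j\rangle|=\frac{1}{\sqrt n}$ for all $1\le i,j\le n$; a set of mutually unbiased bases is a collection of orthonormal bases that are pairwise mutually unbiased. -}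

module Defs where

open import Algebra.Bundles using (RawMonoid)
open import Data.Fin.Base using (Fin)
open import Data.Integer.Base as ℤ using (+_)
import Data.Integer.Properties as ℤ
open import Data.Nat.Base as ℕ using (ℕ; zero; suc)
open import Data.Nat.Coprimality using (1-coprimeTo; sym)
import Data.Nat.Properties as ℕ
open import Data.Product.Base using (∃; _×_; _,_; proj₁; proj₂)
open import Data.Rational.Base as ℚ
  using (ℚ; mkℚ; 0ℚ; 1ℚ; ½; _/_; ↥_; ↧ₙ_) hiding (module ℚ)
import Data.Rational.Properties as ℚ
open import Data.Rational.Solver using (module +-*-Solver)
open import Data.Sum.Base using (_⊎_; inj₁; inj₂)
open import Data.Vec.Functional using (Vector)
open import Function.Definitions using (Injective)
open import Level using (0ℓ)
open import Relation.Binary.PropositionalEquality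
  using (_≡_; _≢_; refl; cong; cong₂; subst; subst₂; trans) renaming (sym to ≡-sym)
open import Relation.Nullary using (¬_; yes; no; contradiction)
open import Relation.Unary using (Pred; _∈_; _≐_)

module RationalLemmas where
  open import Data.Rational.Base using (_+_; _*_; _-_; -_; ∣_∣; _<_; _≤_)
  open ℚ.≤-Reasoning

  *-pos : ∀ {p q} → 0ℚ < p → 0ℚ < q → 0ℚ < p * q
  *-pos {p} {q} 0<p 0<q =
    ℚ.positive⁻¹ _ {{ℚ.pos*pos⇒pos p {{ℚ.positive 0<p}} q {{ℚ.positive 0<q}}}}

  *-mono-≤ : ∀ {a b c d} → 0ℚ ≤ a → a ≤ b → 0ℚ ≤ c → c ≤ d → a * c ≤ b * d
  *-mono-≤ {a} {b} {c} {d} 0≤a a≤b 0≤c c≤d = ℚ.≤-trans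
    (ℚ.*-monoʳ-≤-nonNeg c {{ℚ.nonNegative 0≤c}} a≤b)
    (ℚ.*-monoˡ-≤-nonNeg b {{ℚ.nonNegative (ℚ.≤-trans 0≤a a≤b)}} c≤d)

  ½-pos : 0ℚ < ½
  ½-pos = ℚ.positive⁻¹ ½

  halves : ∀ ε → ½ * ε + ½ * ε ≡ ε
  halves ε = trans (≡-sym (ℚ.*-distribʳ-+ ε ½ ½)) (ℚ.*-identityˡ ε)

  ∣p-q∣≡∣q-p∣ : ∀ p q → ∣ p - q ∣ ≡ ∣ q - p ∣
  ∣p-q∣≡∣q-p∣ p q = trans (cong ∣_∣ (solve 2 (λ p q → p :- q := :- (q :- p)) refl p q)) (ℚ.∣-p∣≡∣p∣ (q - p))
    where open +-*-Solver

  p≤∣p∣ : ∀ p → p ≤ ∣ p ∣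
  p≤∣p∣ p with ℚ.≤-total 0ℚ p
  ... | inj₁ 0≤p = ℚ.≤-reflexive (≡-sym (ℚ.0≤p⇒∣p∣≡p 0≤p))
  ... | inj₂ p≤0 = ℚ.≤-trans p≤0 (ℚ.0≤∣p∣ p)

  p<q+∣p-q∣⁺ : ∀ {p q ε} → ∣ p - q ∣ < ε → p < q + ε
  p<q+∣p-q∣⁺ {p} {q} {ε} lt = begin-strict
    p            ≡⟨ solve 2 (λ p q → p := q :+ (p :- q)) refl p q ⟩
    q + (p - q)  <⟨ ℚ.+-monoʳ-< q (ℚ.≤-<-trans (p≤∣p∣ (p - q)) lt) ⟩
    q + ε        ∎
    where open +-*-Solver

  ∣∣-bound : ∀ p q → ∣ p ∣ ≤ ∣ p - q ∣ + ∣ q ∣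
  ∣∣-bound p q = begin
    ∣ p ∣              ≡⟨ cong ∣_∣ (solve 2 (λ p q → p := (p :- q) :+ q) refl p q) ⟩
    ∣ (p - q) + q ∣    ≤⟨ ℚ.∣p+q∣≤∣p∣+∣q∣ (p - q) q ⟩
    ∣ p - q ∣ + ∣ q ∣  ∎
    where open +-*-Solver

  scale : ∀ {a η} → 0ℚ < a → 0ℚ < η → ∃ λ κ → 0ℚ < κ × a * κ ≡ η
  scale {a} {η} 0<a 0<η = ℚ.1/ a * η , *-pos 0<1/a 0<η ,
    trans (≡-sym (ℚ.*-assoc a (ℚ.1/ a) η))
      (trans (cong (_* η) (ℚ.*-inverseʳ a)) (ℚ.*-identityˡ η))
    where
    instance _ = ℚ.positive 0<a
             _ = ℚ.pos⇒nonZero a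
    0<1/a = ℚ.positive⁻¹ (ℚ.1/ a) {{ℚ.1/pos⇒pos a}}

  *-small : ∀ {a b A κ} → ∣ a ∣ ≤ A → 0ℚ < A → ∣ b ∣ < κ → ∣ a ∣ * ∣ b ∣ < A * κ
  *-small {a} {b} {A} {κ} a≤A 0<A b<κ = ℚ.≤-<-trans
    (ℚ.*-monoʳ-≤-nonNeg ∣ b ∣ {{ℚ.∣-∣-nonNeg b}} a≤A)
    (ℚ.*-monoʳ-<-pos A {{ℚ.positive 0<A}} b<κ)

  *-close : ∀ {a b c d A D κ μ η} → 0ℚ < A → ∣ a ∣ ≤ A → 0ℚ < D → ∣ d ∣ ≤ D →
    ∣ b - d ∣ < κ → ∣ a - c ∣ < μ → A * κ ≡ ½ * η → D * μ ≡ ½ * η →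
    ∣ a * b - c * d ∣ < η
  *-close {a} {b} {c} {d} {A} {D} {κ} {μ} {η} 0<A a≤A 0<D d≤D b~d a~c Aκ≡ Dμ≡ = begin-strict
    ∣ a * b - c * d ∣                      ≡⟨ cong ∣_∣ (solve 4 (λ a b c d → a :* b :- c :* d := a :* (b :- d) :+ d :* (a :- c)) refl a b c d) ⟩
    ∣ a * (b - d) + d * (a - c) ∣          ≤⟨ ℚ.∣p+q∣≤∣p∣+∣q∣ (a * (b - d)) (d * (a - c)) ⟩
    ∣ a * (b - d) ∣ + ∣ d * (a - c) ∣      ≡⟨ cong₂ _+_ (ℚ.∣p*q∣≡∣p∣*∣q∣ a (b - d)) (ℚ.∣p*q∣≡∣p∣*∣q∣ d (a - c)) ⟩
    ∣ a ∣ * ∣ b - d ∣ + ∣ d ∣ * ∣ a - c ∣  <⟨ ℚ.+-mono-< (*-small {a} {b - d} a≤A 0<A b~d) (*-small {d} {a - c} d≤D 0<D a~c) ⟩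
    A * κ + D * μ                          ≡⟨ cong₂ _+_ Aκ≡ Dμ≡ ⟩
    ½ * η + ½ * η                          ≡⟨ halves η ⟩
    η                                      ∎
    where open +-*-Solver

  ∣p-q∣<ε : ∀ {p q ε} → p < q + ε → q < p + ε → ∣ p - q ∣ < ε
  ∣p-q∣<ε {p} {q} {ε} p< q< with ℚ.∣p∣≡p∨∣p∣≡-p (p - q)
  ... | inj₁ eq = subst₂ _<_ (≡-sym eq) (solve 2 (λ q ε → (q :+ ε) :- q := ε) refl q ε) (ℚ.+-monoˡ-< (- q) p<)
    where open +-*-Solver
  ... | inj₂ eq = subst₂ _<_ (≡-sym (trans eq (solve 2 (λ p q → :- (p :- q) := q :- p) refl p q)))
      (solve 2 (λ p ε → (p :+ ε) :- p := ε) refl p ε) (ℚ.+-monoˡ-< (- p) q<)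
    where open +-*-Solver

  n/1 : ∀ n → + n / 1 ≡ mkℚ (+ n) 0 (sym (1-coprimeTo n))
  n/1 n = ℚ.normalize-coprime (sym (1-coprimeTo n))

  suc/1 : ∀ N → + suc N / 1 ≡ (+ N / 1) + 1ℚ
  suc/1 N = trans
    (ℚ./-cong {+ suc N} {1} {+ N ℤ.* + 1 ℤ.+ + 1 ℤ.* + 1} {1}
      (trans (cong +_ (ℕ.+-comm 1 N)) (cong (ℤ._+ + 1) (≡-sym (ℤ.*-identityʳ (+ N))))) refl)
    (cong₂ _+_ (≡-sym (n/1 N)) (≡-sym (n/1 1)))

  */1 : ∀ m n → + (m ℕ.* n) / 1 ≡ (+ m / 1) * (+ n / 1)
  */1 m n = trans (ℚ./-cong {+ (m ℕ.* n)} {1} {+ m ℤ.* + n} {1} (ℤ.pos-* m n) refl)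
    (cong₂ _*_ (≡-sym (n/1 m)) (≡-sym (n/1 n)))

  1≤suc/1 : ∀ n → 1ℚ ≤ + suc n / 1
  1≤suc/1 n = subst (1ℚ ≤_) (≡-sym (n/1 (suc n))) (ℚ.*≤* (ℤ.+≤+ (ℕ.s≤s ℕ.z≤n)))

  <suc∣↥∣ : ∀ q → q < + suc ℤ.∣ ↥ q ∣ / 1
  <suc∣↥∣ q@(mkℚ (+ m) d _) = subst (q <_) (≡-sym (n/1 (suc m)))
    (ℚ.*<* (subst₂ ℤ._<_ (ℤ.pos-* m 1) (ℤ.pos-* (suc m) (suc d))
      (ℤ.+<+ (ℕ.≤-trans (ℕ.≤-reflexive (cong suc (ℕ.*-identityʳ m))) (ℕ.m≤m*n (suc m) (suc d))))))
  <suc∣↥∣ q@(mkℚ ℤ.-[1+ m ] d _) = subst (q <_) (≡-sym (n/1 (suc (suc m)))) (ℚ.*<* ℤ.-<+)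

  step : ℕ → ℚ
  step k = + 1 / suc k

  step≡ : ∀ k → step k ≡ mkℚ (+ 1) k (1-coprimeTo (suc k))
  step≡ k = ℚ.normalize-coprime (1-coprimeTo (suc k))

  suc*step : ∀ k → (+ suc k / 1) * step k ≡ 1ℚ
  suc*step k = trans (cong₂ _*_ (n/1 (suc k)) (step≡ k)) (ℚ.*-inverseʳ (mkℚ (+ suc k) 0 (sym (1-coprimeTo (suc k)))))

  step-pos : ∀ k → 0ℚ < step k
  step-pos k = subst (0ℚ <_) (≡-sym (step≡ k)) (ℚ.positive⁻¹ (mkℚ (+ 1) k (1-coprimeTo (suc k))))

  step-small : ∀ {η} → 0ℚ < η → ∀ k → ↧ₙ η ℕ.≤ k → step k < η
  step-small {mkℚ (+ zero)     d c} 0<η k _ with () ← ℚ.positive 0<η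
  step-small {mkℚ (+ suc p)    d c} 0<η k h = subst (_< _) (≡-sym (step≡ k))
    (ℚ.*<* (ℤ.+<+ (ℕ.s≤s (ℕ.≤-trans (ℕ.≤-reflexive (ℕ.+-identityʳ (suc d))) (ℕ.≤-trans h (ℕ.m≤m+n k _))))))
  step-small {mkℚ ℤ.-[1+ p ]  d c} 0<η k _ with () ← ℚ.positive 0<η

open RationalLemmas

IsCauchy : (ℕ → ℚ) → Set
IsCauchy s = ∀ ε → 0ℚ ℚ.< ε →
  ∃ λ N → ∀ m n → N ℕ.≤ m → N ℕ.≤ n → ℚ.∣ s m ℚ.- s n ∣ ℚ.< ε

-- Cauchy sequences of rationals, with a modulus of convergence carried by
-- the constructive reading of ∃ in IsCauchy; equality of reals is _≈ᴿ_.
record ℝ : Set where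
  constructor mkℝ
  field
    seq    : ℕ → ℚ
    cauchy : IsCauchy seq

open ℝ public

infix 4 _≈ᴿ_

record _≈ᴿ_ (x y : ℝ) : Set where
  constructor mk≈ᴿ
  field
    close : ∀ ε → 0ℚ ℚ.< ε →
      ∃ λ N → ∀ n → N ℕ.≤ n → ℚ.∣ seq x n ℚ.- seq y n ∣ ℚ.< ε

fromℚ : ℚ → ℝ
fromℚ q = mkℝ (λ _ → q) λ ε 0<ε → 0 , λ _ _ _ _ →
  subst (λ p → ℚ.∣ p ∣ ℚ.< ε) (≡-sym (ℚ.+-inverseʳ q)) 0<ε

fromℕ : ℕ → ℝ
fromℕ n = fromℚ (+ n / 1)

0ᴿ 1ᴿ : ℝ
0ᴿ = fromℚ 0ℚ
1ᴿ = fromℚ 1ℚ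

module _ where
  open import Data.Rational.Base using (_+_; _*_; _-_; -_; ∣_∣; _<_; _≤_)
  open ℚ.≤-Reasoning
  open +-*-Solver

  private
    ⊔ˡ : ∀ a b {n} → a ℕ.⊔ b ℕ.≤ n → a ℕ.≤ n
    ⊔ˡ a b = ℕ.≤-trans (ℕ.m≤m⊔n a b)

    ⊔ʳ : ∀ a b {n} → a ℕ.⊔ b ℕ.≤ n → b ℕ.≤ n
    ⊔ʳ a b = ℕ.≤-trans (ℕ.m≤n⊔m a b)

  opaque
    eventually-bounded : (x : ℝ) → ∃ λ A → 0ℚ < A × ∃ λ N → ∀ n → N ℕ.≤ n → ∣ seq x n ∣ ≤ A
    eventually-bounded x with cauchy x 1ℚ (ℚ.positive⁻¹ 1ℚ)
    ... | N , near = 1ℚ + ∣ seq x N ∣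
      , ℚ.<-≤-trans (ℚ.positive⁻¹ 1ℚ) (ℚ.≤-trans (ℚ.≤-reflexive (≡-sym (ℚ.+-identityʳ 1ℚ))) (ℚ.+-monoʳ-≤ 1ℚ (ℚ.0≤∣p∣ (seq x N))))
      , N , λ n N≤n → ℚ.≤-trans (∣∣-bound (seq x n) (seq x N))
          (ℚ.+-monoˡ-≤ ∣ seq x N ∣ (ℚ.<⇒≤ (near n N N≤n ℕ.≤-refl)))

  infixl 6 _+ᴿ_ _-ᴿ_
  infixl 7 _*ᴿ_
  infix  8 -ᴿ_

  _+ᴿ_ : ℝ → ℝ → ℝ
  x +ᴿ y = mkℝ s cau
    where
    s : ℕ → ℚ
    s n = seq x n + seq y n
    opaque
      cau : IsCauchy s
      cau ε 0<ε
        with N₁ , near₁ ← cauchy x (½ * ε) (*-pos ½-pos 0<ε)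
           | N₂ , near₂ ← cauchy y (½ * ε) (*-pos ½-pos 0<ε)
           = N₁ ℕ.⊔ N₂ , λ m n hm hn → let a = seq x m; b = seq y m; c = seq x n; d = seq y n in begin-strict
             ∣ (a + b) - (c + d) ∣    ≡⟨ cong ∣_∣ (solve 4 (λ a b c d → (a :+ b) :- (c :+ d) := (a :- c) :+ (b :- d)) refl a b c d) ⟩
             ∣ (a - c) + (b - d) ∣    ≤⟨ ℚ.∣p+q∣≤∣p∣+∣q∣ (a - c) (b - d) ⟩
             ∣ a - c ∣ + ∣ b - d ∣    <⟨ ℚ.+-mono-< (near₁ m n (⊔ˡ N₁ N₂ hm) (⊔ˡ N₁ N₂ hn)) (near₂ m n (⊔ʳ N₁ N₂ hm) (⊔ʳ N₁ N₂ hn)) ⟩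
             ½ * ε + ½ * ε            ≡⟨ halves ε ⟩
             ε                        ∎

  -ᴿ_ : ℝ → ℝ
  -ᴿ x = mkℝ s cau
    where
    s : ℕ → ℚ
    s n = - seq x n
    opaque
      cau : IsCauchy s
      cau ε 0<ε with N , near ← cauchy x ε 0<ε = N , λ m n hm hn → let a = seq x m; c = seq x n in begin-strict
        ∣ - a - - c ∣  ≡⟨ cong ∣_∣ (solve 2 (λ a c → :- a :- :- c := :- (a :- c)) refl a c) ⟩
        ∣ - (a - c) ∣  ≡⟨ ℚ.∣-p∣≡∣p∣ (a - c) ⟩
        ∣ a - c ∣      <⟨ near m n hm hn ⟩
        ε              ∎

  _-ᴿ_ : ℝ → ℝ → ℝ
  x -ᴿ y = x +ᴿ (-ᴿ y)

  _*ᴿ_ : ℝ → ℝ → ℝ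
  x *ᴿ y = mkℝ s cau
    where
    s : ℕ → ℚ
    s n = seq x n * seq y n
    opaque
      cau : IsCauchy s
      cau ε 0<ε
        with A , 0<A , N₁ , x≤A ← eventually-bounded x
           | D , 0<D , N₂ , y≤D ← eventually-bounded y
        with κ , 0<κ , Aκ≡ ← scale 0<A (*-pos ½-pos 0<ε)
           | μ , 0<μ , Dμ≡ ← scale 0<D (*-pos ½-pos 0<ε)
        with N₃ , near₁ ← cauchy x μ 0<μ
           | N₄ , near₂ ← cauchy y κ 0<κ
           = (N₁ ℕ.⊔ N₂) ℕ.⊔ (N₃ ℕ.⊔ N₄) , λ m n hm hn →
             *-close {seq x m} {seq y m} {seq x n} {seq y n} {A} {D} {κ} {μ} {ε}
               0<A (x≤A m (⊔ˡ N₁ N₂ (⊔ˡ (N₁ ℕ.⊔ N₂) _ hm)))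
               0<D (y≤D n (⊔ʳ N₁ N₂ (⊔ˡ (N₁ ℕ.⊔ N₂) _ hn)))
               (near₂ m n (⊔ʳ N₃ N₄ (⊔ʳ (N₁ ℕ.⊔ N₂) _ hm)) (⊔ʳ N₃ N₄ (⊔ʳ (N₁ ℕ.⊔ N₂) _ hn)))
               (near₁ m n (⊔ˡ N₃ N₄ (⊔ʳ (N₁ ℕ.⊔ N₂) _ hm)) (⊔ˡ N₃ N₄ (⊔ʳ (N₁ ℕ.⊔ N₂) _ hn)))
               Aκ≡ Dμ≡

  PositiveAfter : ℚ → ℕ → ℝ → Set
  PositiveAfter e N x = ∀ n → N ℕ.≤ n → e ≤ seq x n

  Positiveᴿ : ℝ → Set
  Positiveᴿ x = ∃ λ e → 0ℚ < e × ∃ λ N → PositiveAfter e N x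

  -- Total reciprocal with recip 0ℚ = 0ℚ: finitely many terms of a sequence
  -- representing a positive real may vanish.
  recip : ℚ → ℚ
  recip q with q ℚ.≟ 0ℚ
  ... | yes _   = 0ℚ
  ... | no  q≢0 = (ℚ.1/ q) {{ℚ.≢-nonZero q≢0}}

  recip-inverseʳ : ∀ q → q ≢ 0ℚ → q * recip q ≡ 1ℚ
  recip-inverseʳ q q≢0 with q ℚ.≟ 0ℚ
  ... | yes q≡0 = contradiction q≡0 q≢0
  ... | no  q≢0 = ℚ.*-inverseʳ q {{ℚ.≢-nonZero q≢0}}

  recip-lipschitz : ∀ {e a b} → 0ℚ < e → e ≤ a → e ≤ b →
    (e * e) * ∣ recip a - recip b ∣ ≤ ∣ a - b ∣
  recip-lipschitz {e} {a} {b} 0<e e≤a e≤b = begin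
    (e * e) * ∣ a⁻¹ - b⁻¹ ∣          ≤⟨ ℚ.*-monoʳ-≤-nonNeg ∣ a⁻¹ - b⁻¹ ∣ {{ℚ.∣-∣-nonNeg (a⁻¹ - b⁻¹)}} (*-mono-≤ 0≤e e≤a 0≤e e≤b) ⟩
    (a * b) * ∣ a⁻¹ - b⁻¹ ∣          ≡⟨ cong (_* ∣ a⁻¹ - b⁻¹ ∣) (ℚ.0≤p⇒∣p∣≡p 0≤ab) ⟨
    ∣ a * b ∣ * ∣ a⁻¹ - b⁻¹ ∣        ≡⟨ ℚ.∣p*q∣≡∣p∣*∣q∣ (a * b) (a⁻¹ - b⁻¹) ⟨
    ∣ (a * b) * (a⁻¹ - b⁻¹) ∣        ≡⟨ cong ∣_∣ (solve 4 (λ a b c d → (a :* b) :* (c :- d) := (a :* c) :* b :- (b :* d) :* a) refl a b a⁻¹ b⁻¹) ⟩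
    ∣ (a * a⁻¹) * b - (b * b⁻¹) * a ∣ ≡⟨ cong₂ (λ u v → ∣ u * b - v * a ∣) (recip-inverseʳ a (≢0 e≤a)) (recip-inverseʳ b (≢0 e≤b)) ⟩
    ∣ 1ℚ * b - 1ℚ * a ∣              ≡⟨ cong₂ (λ u v → ∣ u - v ∣) (ℚ.*-identityˡ b) (ℚ.*-identityˡ a) ⟩
    ∣ b - a ∣                        ≡⟨ ∣p-q∣≡∣q-p∣ b a ⟩
    ∣ a - b ∣                        ∎
    where
    a⁻¹ = recip a
    b⁻¹ = recip b
    0≤e = ℚ.<⇒≤ 0<e
    ≢0 : ∀ {q} → e ≤ q → q ≢ 0ℚ
    ≢0 e≤q refl = ℚ.<-irrefl refl (ℚ.<-≤-trans 0<e e≤q)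
    0≤ab : 0ℚ ≤ a * b
    0≤ab = ℚ.<⇒≤ (*-pos (ℚ.<-≤-trans 0<e e≤a) (ℚ.<-≤-trans 0<e e≤b))

  invᴿ : (x : ℝ) → Positiveᴿ x → ℝ
  invᴿ x (e , 0<e , N₀ , e≤x) = mkℝ s cau
    where
    s : ℕ → ℚ
    s n = recip (seq x n)
    opaque
      cau : IsCauchy s
      cau ε 0<ε with N₁ , near ← cauchy x ((e * e) * ε) (*-pos (*-pos 0<e 0<e) 0<ε) =
        N₀ ℕ.⊔ N₁ , λ m n hm hn →
          ℚ.*-cancelˡ-<-nonNeg (e * e) {{ℚ.nonNegative (ℚ.<⇒≤ (*-pos 0<e 0<e))}}
            (ℚ.≤-<-trans (recip-lipschitz 0<e (e≤x m (⊔ˡ N₀ N₁ hm)) (e≤x n (⊔ˡ N₀ N₁ hn)))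
              (near m n (⊔ʳ N₀ N₁ hm) (⊔ʳ N₀ N₁ hn)))

  -- climb δ q N is the largest r among 0, δ, 2δ, …, Nδ that is 0 or has
  -- r² ≤ q, provided δ > 0.
  climb : ℚ → ℚ → ℕ → ℚ
  climb δ q zero = 0ℚ
  climb δ q (suc N) with (climb δ q N + δ) * (climb δ q N + δ) ℚ.≤? q
  ... | yes _ = climb δ q N + δ
  ... | no  _ = climb δ q N

  -- Approximates √ q to within 1/(k + 1) if q ≥ 0 and is 0 if q < 0.
  -- The bound (k + 1)(1 + ∣ numerator of q ∣) on the number of steps of
  -- size 1/(k + 1) guarantees that the search passes √ q.
  √approx : ℕ → ℚ → ℚ
  √approx k q = climb (step k) q (suc k ℕ.* suc ℤ.∣ ↥ q ∣)

  climb-nonneg : ∀ {δ} → 0ℚ < δ → ∀ q N → 0ℚ ≤ climb δ q N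
  climb-nonneg 0<δ q zero = ℚ.≤-refl
  climb-nonneg {δ} 0<δ q (suc N) with (climb δ q N + δ) * (climb δ q N + δ) ℚ.≤? q
  ... | yes _ = ℚ.+-mono-≤ (climb-nonneg 0<δ q N) (ℚ.<⇒≤ 0<δ)
  ... | no  _ = climb-nonneg 0<δ q N

  climb-below : ∀ δ q N → climb δ q N ≡ 0ℚ ⊎ climb δ q N * climb δ q N ≤ q
  climb-below δ q zero = inj₁ refl
  climb-below δ q (suc N) with (climb δ q N + δ) * (climb δ q N + δ) ℚ.≤? q
  ... | yes h = inj₂ h
  ... | no  _ = climb-below δ q N

  climb-max : ∀ δ q N → climb δ q N ≡ (+ N / 1) * δ ⊎ q < (climb δ q N + δ) * (climb δ q N + δ)
  climb-max δ q zero = inj₁ (≡-sym (ℚ.*-zeroˡ δ))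
  climb-max δ q (suc N) with (climb δ q N + δ) * (climb δ q N + δ) ℚ.≤? q | climb-max δ q N
  ... | no  ≰q | _       = inj₂ (ℚ.≰⇒> ≰q)
  ... | yes ≤q | inj₂ q< = contradiction ≤q (λ h → ℚ.<-irrefl refl (ℚ.<-≤-trans q< h))
  ... | yes ≤q | inj₁ eq = inj₁ (trans (cong (_+ δ) eq)
      (trans (solve 2 (λ a d → a :* d :+ d := (a :+ con 1ℚ) :* d) refl (+ N / 1) δ) (cong (_* δ) (≡-sym (suc/1 N)))))

  climb-above : ∀ δ q N L → 0ℚ < δ → (+ N / 1) * δ ≡ L → 1ℚ ≤ L → q < L →
    q < (climb δ q N + δ) * (climb δ q N + δ)
  climb-above δ q N L 0<δ Nδ≡L 1≤L q<L with climb-max δ q N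
  ... | inj₂ q<  = q<
  ... | inj₁ r≡Nδ = begin-strict
    q                  <⟨ q<L ⟩
    L                  ≡⟨ ℚ.*-identityˡ L ⟨
    1ℚ * L             ≤⟨ *-mono-≤ 0≤1 (ℚ.≤-trans 1≤L L≤r+δ) (ℚ.≤-trans 0≤1 1≤L) L≤r+δ ⟩
    (r + δ) * (r + δ)  ∎
    where
    r = climb δ q N
    0≤1 : 0ℚ ≤ 1ℚ
    0≤1 = ℚ.<⇒≤ (ℚ.positive⁻¹ 1ℚ)
    L≤r+δ : L ≤ r + δ
    L≤r+δ = begin
      L       ≡⟨ trans r≡Nδ Nδ≡L ⟨
      r       ≡⟨ ℚ.+-identityʳ r ⟨
      r + 0ℚ  ≤⟨ ℚ.+-monoʳ-≤ r (ℚ.<⇒≤ 0<δ) ⟩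
      r + δ   ∎

  √approx-nonneg : ∀ k q → 0ℚ ≤ √approx k q
  √approx-nonneg k q = climb-nonneg (step-pos k) q (suc k ℕ.* suc ℤ.∣ ↥ q ∣)

  √approx-below : ∀ k q → √approx k q ≡ 0ℚ ⊎ √approx k q * √approx k q ≤ q
  √approx-below k q = climb-below (step k) q (suc k ℕ.* suc ℤ.∣ ↥ q ∣)

  √approx-above : ∀ k q → q < (√approx k q + step k) * (√approx k q + step k)
  √approx-above k q = climb-above (step k) q (suc k ℕ.* M) (+ M / 1) (step-pos k) total
    (1≤suc/1 ℤ.∣ ↥ q ∣) (<suc∣↥∣ q)
    where
    M = suc ℤ.∣ ↥ q ∣
    reorder : ∀ a b c → a * b * c ≡ a * c * b
    reorder = solve 3 (λ a b c → a :* b :* c := a :* c :* b) refl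
    total : (+ (suc k ℕ.* M) / 1) * step k ≡ + M / 1
    total = trans (cong (_* step k) (*/1 (suc k) M))
      (trans (reorder (+ suc k / 1) (+ M / 1) (step k))
        (trans (cong (_* (+ M / 1)) (suc*step k)) (ℚ.*-identityˡ (+ M / 1))))

  √-separation : ∀ {ε p q r s δ} → 0ℚ < ε → 0ℚ ≤ s → 0ℚ < δ → δ < ½ * ε →
    r ≡ 0ℚ ⊎ r * r ≤ p → q < (s + δ) * (s + δ) →
    ∣ p - q ∣ < (½ * ε) * (½ * ε) → r < s + ε
  √-separation {ε} {p} {q} {r} {s} {δ} 0<ε 0≤s 0<δ δ<h (inj₁ refl) _ _ =
    ℚ.≤-<-trans 0≤s (subst (_< s + ε) (ℚ.+-identityʳ s) (ℚ.+-monoʳ-< s 0<ε))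
  √-separation {ε} {p} {q} {r} {s} {δ} 0<ε 0≤s 0<δ δ<h (inj₂ r²≤p) q<b² p~q =
    ℚ.≰⇒> λ s+ε≤r → contradiction (chain s+ε≤r) (ℚ.<-irrefl refl)
    where
    h = ½ * ε
    b = s + δ
    0≤h : 0ℚ ≤ h
    0≤h = ℚ.<⇒≤ (*-pos ½-pos 0<ε)
    0≤b : 0ℚ ≤ b
    0≤b = ℚ.+-mono-≤ 0≤s (ℚ.<⇒≤ 0<δ)
    0≤b+h : 0ℚ ≤ b + h
    0≤b+h = ℚ.+-mono-≤ 0≤b 0≤h
    0≤bh : 0ℚ ≤ b * h
    0≤bh = *-mono-≤ {0ℚ} {b} {0ℚ} {h} ℚ.≤-refl 0≤b ℚ.≤-refl 0≤h
    0≤2bh : 0ℚ ≤ b * h + b * h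
    0≤2bh = ℚ.+-mono-≤ 0≤bh 0≤bh
    expand : ∀ b h → b * b + h * h + (b * h + b * h) ≡ (b + h) * (b + h)
    expand = solve 2 (λ b h → b :* b :+ h :* h :+ (b :* h :+ b :* h) := (b :+ h) :* (b :+ h)) refl
    b+h≤ : b + h ≤ s + ε
    b+h≤ = begin
      (s + δ) + h  ≤⟨ ℚ.+-monoˡ-≤ h (ℚ.+-monoʳ-≤ s (ℚ.<⇒≤ δ<h)) ⟩
      (s + h) + h  ≡⟨ ℚ.+-assoc s h h ⟩
      s + (h + h)  ≡⟨ cong (_+_ s) (halves ε) ⟩
      s + ε        ∎
    chain : s + ε ≤ r → q + h * h < q + h * h
    chain s+ε≤r = begin-strict
      q + h * h                        <⟨ ℚ.+-monoˡ-< (h * h) q<b² ⟩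
      b * b + h * h                    ≡⟨ ℚ.+-identityʳ (b * b + h * h) ⟨
      b * b + h * h + 0ℚ               ≤⟨ ℚ.+-monoʳ-≤ (b * b + h * h) 0≤2bh ⟩
      b * b + h * h + (b * h + b * h)  ≡⟨ expand b h ⟩
      (b + h) * (b + h)                ≤⟨ *-mono-≤ 0≤b+h b+h≤r 0≤b+h b+h≤r ⟩
      r * r                            ≤⟨ r²≤p ⟩
      p                                <⟨ p<q+∣p-q∣⁺ p~q ⟩
      q + h * h                        ∎
      where
      b+h≤r : b + h ≤ r
      b+h≤r = ℚ.≤-trans b+h≤ s+ε≤r

  √approx-continuous : ∀ {ε} → 0ℚ < ε → ∀ k l p q → step l < ½ * ε →
    ∣ p - q ∣ < (½ * ε) * (½ * ε) → √approx k p < √approx l q + ε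
  √approx-continuous 0<ε k l p q δ<h p~q = √-separation 0<ε (√approx-nonneg l q) (step-pos l)
    δ<h (√approx-below k p) (√approx-above l q) p~q

  √ᴿ_ : ℝ → ℝ
  √ᴿ x = mkℝ s cau
    where
    s : ℕ → ℚ
    s k = √approx k (seq x k)
    opaque
      cau : IsCauchy s
      cau ε 0<ε = N ℕ.⊔ K , λ m n hm hn → ∣p-q∣<ε
        (√approx-continuous 0<ε m n (seq x m) (seq x n)
          (step-small 0<h n (⊔ʳ N K hn)) (near m n (⊔ˡ N K hm) (⊔ˡ N K hn)))
        (√approx-continuous 0<ε n m (seq x n) (seq x m)
          (step-small 0<h m (⊔ʳ N K hm)) (near n m (⊔ˡ N K hn) (⊔ˡ N K hm)))
        where
        h : ℚ
        h = ½ * ε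
        0<h : 0ℚ < h
        0<h = *-pos ½-pos 0<ε
        K : ℕ
        K = ↧ₙ h
        modulus : ∃ λ N → ∀ m n → N ℕ.≤ m → N ℕ.≤ n → ∣ seq x m - seq x n ∣ < h * h
        modulus = cauchy x (h * h) (*-pos 0<h 0<h)
        N : ℕ
        N = proj₁ modulus
        near : ∀ m n → N ℕ.≤ m → N ℕ.≤ n → ∣ seq x m - seq x n ∣ < h * h
        near = proj₂ modulus

  √ᴿ-positive : ∀ x → Positiveᴿ x → Positiveᴿ (√ᴿ x)
  √ᴿ-positive x (e , 0<e , N , e≤x) = bound (small 0<e)
    where
    small : ∀ {e} → 0ℚ < e → ∃ λ w → 0ℚ < w × w ≤ e × w ≤ 1ℚ
    small {e} 0<e with ℚ.≤-total e 1ℚ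
    ... | inj₁ e≤1 = e , 0<e , ℚ.≤-refl , e≤1
    ... | inj₂ 1≤e = 1ℚ , ℚ.positive⁻¹ 1ℚ , 1≤e , ℚ.≤-refl
    bound : (∃ λ w → 0ℚ < w × w ≤ e × w ≤ 1ℚ) → Positiveᴿ (√ᴿ x)
    bound (w , 0<w , w≤e , w≤1) = h , 0<h , N ℕ.⊔ K , after
      where
      h = ½ * w
      0<h : 0ℚ < h
      0<h = *-pos ½-pos 0<w
      K = ↧ₙ h
      abstract
        w²≤e : w * w ≤ e
        w²≤e = ℚ.≤-trans (*-mono-≤ (ℚ.<⇒≤ 0<w) w≤e (ℚ.<⇒≤ 0<w) w≤1) (ℚ.≤-reflexive (ℚ.*-identityʳ e))
        separated : ∀ {q r δ} → 0ℚ ≤ r → 0ℚ < δ → δ < h → e ≤ q → q < (r + δ) * (r + δ) → h ≤ r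
        separated {q} {r} {δ} 0≤r 0<δ δ<h e≤q q< = ℚ.≮⇒≥ λ r<h →
          let 0≤r+δ = ℚ.+-mono-≤ 0≤r (ℚ.<⇒≤ 0<δ)
              r+δ≤w = ℚ.≤-trans (ℚ.<⇒≤ (ℚ.+-mono-< r<h δ<h)) (ℚ.≤-reflexive (halves w))
          in ℚ.<-irrefl refl (ℚ.<-≤-trans q<
               (ℚ.≤-trans (*-mono-≤ 0≤r+δ r+δ≤w 0≤r+δ r+δ≤w) (ℚ.≤-trans w²≤e e≤q)))
        after : PositiveAfter h (N ℕ.⊔ K) (√ᴿ x)
        after n hn = separated (√approx-nonneg n (seq x n)) (step-pos n)
          (step-small 0<h n (⊔ʳ N K hn)) (e≤x n (⊔ˡ N K hn)) (√approx-above n (seq x n))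

fromℕ-positive : ∀ n .{{_ : ℕ.NonZero n}} → Positiveᴿ (fromℕ n)
fromℕ-positive (suc n) = 1ℚ , ℚ.positive⁻¹ 1ℚ , 0 , λ _ _ → 1≤suc/1 n

1/√_ : ∀ n .{{_ : ℕ.NonZero n}} → ℝ
1/√ n = invᴿ (√ᴿ fromℕ n) (√ᴿ-positive (fromℕ n) (fromℕ-positive n))

record ℂ : Set where
  constructor _+i_
  field
    re im : ℝ

open ℂ public

infix  4 _≈ᶜ_
infixl 6 _+ᶜ_
infixl 7 _*ᶜ_

record _≈ᶜ_ (z w : ℂ) : Set where
  constructor mk≈ᶜ
  field
    re-≈ : re z ≈ᴿ re w
    im-≈ : im z ≈ᴿ im w

0ᶜ 1ᶜ : ℂ
0ᶜ = 0ᴿ +i 0ᴿ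
1ᶜ = 1ᴿ +i 0ᴿ

_+ᶜ_ _*ᶜ_ : ℂ → ℂ → ℂ
z +ᶜ w = (re z +ᴿ re w) +i (im z +ᴿ im w)
z *ᶜ w = (re z *ᴿ re w -ᴿ im z *ᴿ im w) +i (re z *ᴿ im w +ᴿ im z *ᴿ re w)

conj : ℂ → ℂ
conj z = re z +i (-ᴿ im z)

∣_∣ᶜ : ℂ → ℝ
∣ z ∣ᶜ = √ᴿ (re z *ᴿ re z +ᴿ im z *ᴿ im z)

+ᶜ-0-rawMonoid : RawMonoid 0ℓ 0ℓ
+ᶜ-0-rawMonoid = record { _≈_ = _≈ᶜ_ ; _∙_ = _+ᶜ_ ; ε = 0ᶜ }

open import Algebra.Definitions.RawMonoid +ᶜ-0-rawMonoid public using (sum)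

infix 4 _≈ᵛ_

_≈ᵛ_ : ∀ {n} → Vector ℂ n → Vector ℂ n → Set
u ≈ᵛ v = ∀ i → u i ≈ᶜ v i

0ᵛ : ∀ {n} → Vector ℂ n
0ᵛ _ = 0ᶜ

⟨_,_⟩ : ∀ {n} → Vector ℂ n → Vector ℂ n → ℂ
⟨ u , v ⟩ = sum λ i → conj (u i) *ᶜ v i

combination : ∀ {k n} → Vector ℂ k → Vector (Vector ℂ n) k → Vector ℂ n
combination c b j = sum λ i → c i *ᶜ b i j

record IsBasis {n} (b : Vector (Vector ℂ n) n) : Set where
  field
    independent : ∀ c → combination c b ≈ᵛ 0ᵛ → ∀ i → c i ≈ᶜ 0ᶜ
    spanning    : ∀ v → ∃ λ c → combination c b ≈ᵛ v

record IsOrthonormalBasis {n} (b : Vector (Vector ℂ n) n) : Set where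
  field
    isBasis    : IsBasis b
    normalised : ∀ i → ⟨ b i , b i ⟩ ≈ᶜ 1ᶜ
    orthogonal : ∀ i j → i ≢ j → ⟨ b i , b j ⟩ ≈ᶜ 0ᶜ

  open IsBasis isBasis public

Unbiased : ∀ {n} .{{_ : ℕ.NonZero n}} → (a b : Vector (Vector ℂ n) n) → Set
Unbiased {n} a b = ∀ i j → ∣ ⟨ a i , b j ⟩ ∣ᶜ ≈ᴿ 1/√ n

AreMutuallyUnbiasedBases : ∀ {m n} .{{_ : ℕ.NonZero n}} →
  Vector (Vector (Vector ℂ n) n) m → Set
AreMutuallyUnbiasedBases B =
  (∀ k → IsOrthonormalBasis (B k)) × (∀ k l → k ≢ l → Unbiased (B k) (B l))

Matrix : ℕ → Set
Matrix n = Fin n → Fin n → ℂ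

infix  4 _≈ᴹ_
infixl 7 _·_
infix  8 _†

_≈ᴹ_ : ∀ {n} → Matrix n → Matrix n → Set
A ≈ᴹ B = ∀ i j → A i j ≈ᶜ B i j

_·_ : ∀ {n} → Matrix n → Matrix n → Matrix n
(A · B) i j = sum λ k → A i k *ᶜ B k j

_† : ∀ {n} → Matrix n → Matrix n
(A †) i j = conj (A j i)

tr : ∀ {n} → Matrix n → ℂ
tr A = sum λ i → A i i

Orthogonal : ∀ {n} → Matrix n → Matrix n → Set
Orthogonal A B = tr (A † · B) ≈ᶜ 0ᶜ

Normal : ∀ {n} → Matrix n → Set
Normal A = A · A † ≈ᴹ A † · A

-- S has exactly k elements, matrices being identified when entrywise equal.
HasSize : ∀ {n} → ℕ → Pred (Matrix n) 0ℓ → Set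
HasSize {n} k S = ∃ λ (f : Fin k → Matrix n) →
  Injective _≡_ _≈ᴹ_ f × S ≐ (λ A → ∃ λ i → A ≈ᴹ f i)

record IsCommutingNormalClass {n} (S : Pred (Matrix n) 0ℓ) : Set where
  field
    size    : HasSize n S
    normal  : ∀ {A} → A ∈ S → Normal A
    commute : ∀ {A B} → A ∈ S → B ∈ S → A · B ≈ᴹ B · A

PairwiseOrthogonal : ∀ {n} → Pred (Matrix n) 0ℓ → Set
PairwiseOrthogonal S = ∀ {A B} → A ∈ S → B ∈ S → ¬ A ≈ᴹ B → Orthogonal A B

{-# OPTIONS --safe #-}

-- For an orthonormal basis b and a real vector h, the matrix ∑ₓ hₓ ∣bₓ⟩⟨bₓ∣ is
-- Hermitian, and all such matrices commute. The trace inner product of two of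
-- them is ∑ₓ hₓ h′ₓ for one and the same basis and ∑ₓ∑ᵧ hₓ h′ᵧ ∣⟨aₓ,bᵧ⟩∣² =
-- (∑h)(∑h′)/n for unbiased bases a, b. Take for h the members of an orthogonal
-- basis of ℚⁿ containing (1,…,1): the other members have sum zero, so two
-- matrices from different classes are orthogonal unless both come from
-- (1,…,1), and then both are the identity. Real coefficients avoid the roots of
-- unity, which would make the matrices unitary.
module Submission where

open import Algebra.Bundles using (CommutativeRing)
import Algebra.Properties.Semiring.Sum as SemiringSum
import Algebra.Solver.CommutativeMonoid as CommutativeMonoidSolver
open import Algebra.Structures using (IsCommutativeRing)
open import Defs
open import Data.Fin.Base using (Fin; zero; suc; punchIn)
open import Data.Fin.Properties using (punchInᵢ≢i; _≟_)
open import Data.Nat.Base as ℕ using (ℕ; NonZero; _≤_; zero; suc)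
import Data.Nat.Properties as ℕ
open import Data.Product.Base using (∃; _×_; _,_)
open import Data.Rational.Base as ℚ using (ℚ; 0ℚ; 1ℚ; ½; ↧ₙ_)
import Data.Rational.Properties as ℚ
open import Data.Rational.Solver using (module +-*-Solver)
open import Data.Sum.Base using (_⊎_; inj₁; inj₂)
open import Data.Vec.Functional using (Vector; updateAt)
open import Data.Vec.Functional.Properties using (updateAt-updates; updateAt-minimal)
open import Function.Base using (_∘_; const; id)
open import Level using (0ℓ)
open import Relation.Binary.PropositionalEquality as ≡ using (_≡_; _≢_)
import Relation.Binary.Reasoning.Setoid as SetoidReasoning
open import Relation.Binary.Structures using (IsEquivalence)
open import Relation.Nullary using (¬_; Dec; yes; no; contradiction)
open import Relation.Nullary.Decidable using (decidable-stable)
open import Relation.Unary using (Pred; ⋃; _≐_)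
open RationalLemmas

-- Equality of Cauchy reals and its compatibility with the operations.

pointwise : ∀ {x y} → (∀ n → seq x n ≡ seq y n) → x ≈ᴿ y
pointwise {x} {y} eq = mk≈ᴿ λ ε 0<ε → 0 , λ n _ →
  ≡.subst (λ p → ℚ.∣ p ∣ ℚ.< ε)
    (≡.sym (≡.trans (≡.cong (ℚ._- seq y n) (eq n)) (ℚ.+-inverseʳ (seq y n)))) 0<ε

≈ᴿ-refl : ∀ {x} → x ≈ᴿ x
≈ᴿ-refl = pointwise λ _ → ≡.refl

≈ᴿ-sym : ∀ {x y} → x ≈ᴿ y → y ≈ᴿ x
≈ᴿ-sym {x} {y} (mk≈ᴿ close) = mk≈ᴿ λ ε 0<ε → let N , near = close ε 0<ε in
  N , λ n N≤n → ≡.subst (ℚ._< ε) (∣p-q∣≡∣q-p∣ (seq x n) (seq y n)) (near n N≤n)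

module _ where
  open import Data.Rational.Base using (_+_; _*_; _-_; -_; ∣_∣; _<_)
  open ℚ.≤-Reasoning
  open +-*-Solver

  -- The shape shared by transitivity and additive congruence: an error that
  -- is eventually the sum of two vanishing errors vanishes.
  ≈ᴿ-split : ∀ {x y a b c d} → (∀ n → seq x n - seq y n ≡ (seq a n - seq b n) + (seq c n - seq d n)) →
    a ≈ᴿ b → c ≈ᴿ d → x ≈ᴿ y
  ≈ᴿ-split {x} {y} {a} {b} {c} {d} eq (mk≈ᴿ a≈b) (mk≈ᴿ c≈d) = mk≈ᴿ λ ε 0<ε →
    let N₁ , near₁ = a≈b (½ * ε) (*-pos ½-pos 0<ε)
        N₂ , near₂ = c≈d (½ * ε) (*-pos ½-pos 0<ε)
    in N₁ ℕ.⊔ N₂ , λ n N≤n → begin-strict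
      ∣ seq x n - seq y n ∣                              ≡⟨ ≡.cong ∣_∣ (eq n) ⟩
      ∣ (seq a n - seq b n) + (seq c n - seq d n) ∣      ≤⟨ ℚ.∣p+q∣≤∣p∣+∣q∣ (seq a n - seq b n) (seq c n - seq d n) ⟩
      ∣ seq a n - seq b n ∣ + ∣ seq c n - seq d n ∣      <⟨ ℚ.+-mono-< (near₁ n (ℕ.m⊔n≤o⇒m≤o N₁ N₂ N≤n)) (near₂ n (ℕ.m⊔n≤o⇒n≤o N₁ N₂ N≤n)) ⟩
      ½ * ε + ½ * ε                                      ≡⟨ halves ε ⟩
      ε                                                  ∎

  ≈ᴿ-trans : ∀ {x y z} → x ≈ᴿ y → y ≈ᴿ z → x ≈ᴿ z
  ≈ᴿ-trans {x} {y} {z} = ≈ᴿ-split λ n →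
    solve 3 (λ x y z → x :- z := (x :- y) :+ (y :- z)) ≡.refl (seq x n) (seq y n) (seq z n)

  +ᴿ-cong : ∀ {x y u v} → x ≈ᴿ y → u ≈ᴿ v → x +ᴿ u ≈ᴿ y +ᴿ v
  +ᴿ-cong {x} {y} {u} {v} = ≈ᴿ-split λ n →
    solve 4 (λ x y u v → (x :+ u) :- (y :+ v) := (x :- y) :+ (u :- v)) ≡.refl
      (seq x n) (seq y n) (seq u n) (seq v n)

  -ᴿ-cong : ∀ {x y} → x ≈ᴿ y → -ᴿ x ≈ᴿ -ᴿ y
  -ᴿ-cong {x} {y} (mk≈ᴿ x≈y) = mk≈ᴿ λ ε 0<ε → let N , near = x≈y ε 0<ε in
    N , λ n N≤n → ≡.subst (_< ε)
      (≡.trans (∣p-q∣≡∣q-p∣ (seq x n) (seq y n))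
        (≡.cong ∣_∣ (solve 2 (λ x y → y :- x := :- x :- :- y) ≡.refl (seq x n) (seq y n))))
      (near n N≤n)

  -- The error splits as x(u - v) + v(x - y), so eventual bounds `A` for `x` and `D` for `v`
  -- suffice. The tolerances `κ` and `μ` are chosen to make each summand smaller than ε/2.
  *ᴿ-cong : ∀ {x y u v} → x ≈ᴿ y → u ≈ᴿ v → x *ᴿ u ≈ᴿ y *ᴿ v
  *ᴿ-cong {x} {y} {u} {v} (mk≈ᴿ x≈y) (mk≈ᴿ u≈v) = mk≈ᴿ λ ε 0<ε →
    let A , 0<A , N₁ , x≤A = eventually-bounded x
        D , 0<D , N₂ , v≤D = eventually-bounded v
        κ , 0<κ , Aκ≡      = scale 0<A (*-pos ½-pos 0<ε)
        μ , 0<μ , Dμ≡      = scale 0<D (*-pos ½-pos 0<ε)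
        N₃ , near₁         = x≈y μ 0<μ
        N₄ , near₂         = u≈v κ 0<κ
    in (N₁ ℕ.⊔ N₂) ℕ.⊔ (N₃ ℕ.⊔ N₄) , λ n N≤n →
      let N₁₂≤n = ℕ.m⊔n≤o⇒m≤o (N₁ ℕ.⊔ N₂) (N₃ ℕ.⊔ N₄) N≤n
          N₃₄≤n = ℕ.m⊔n≤o⇒n≤o (N₁ ℕ.⊔ N₂) (N₃ ℕ.⊔ N₄) N≤n
      in *-close {seq x n} {seq u n} {seq y n} {seq v n} {A} {D} {κ} {μ} {ε}
        0<A (x≤A n (ℕ.m⊔n≤o⇒m≤o N₁ N₂ N₁₂≤n)) 0<D (v≤D n (ℕ.m⊔n≤o⇒n≤o N₁ N₂ N₁₂≤n))
        (near₂ n (ℕ.m⊔n≤o⇒n≤o N₃ N₄ N₃₄≤n)) (near₁ n (ℕ.m⊔n≤o⇒m≤o N₃ N₄ N₃₄≤n)) Aκ≡ Dμ≡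

  -- Rational constants and square roots of reals.

  fromℚ-≈0 : ∀ {q} → fromℚ q ≈ᴿ 0ᴿ → q ≡ 0ℚ
  fromℚ-≈0 {q} (mk≈ᴿ q≈0) = ℚ.∣p∣≡0⇒p≡0 q (ℚ.≤-antisym
    (ℚ.≮⇒≥ λ 0<∣q∣ → let N , near = q≈0 ∣ q ∣ 0<∣q∣ in
      ℚ.<-irrefl (≡.cong ∣_∣ (ℚ.+-identityʳ q)) (near N ℕ.≤-refl))
    (ℚ.0≤∣p∣ q))

  -- The search stops at some r with r² ≤ q, or r = 0, and q < (r + δ)² = r² + (2r + δ)δ. With r ≤ A
  -- and δ < 1 the excess is at most (2A + 1)δ. The case r = 0 is where `0ℚ ≤ q` enters.
  √approx-square : ∀ {k q A ε} → 0ℚ ℚ.≤ q → 0ℚ < A → √approx k q ℚ.≤ A → step k < 1ℚ →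
    (A + A + 1ℚ) * step k < ε → ∣ √approx k q * √approx k q - q ∣ < ε
  √approx-square {k} {q} {A} {ε} 0≤q 0<A r≤A δ<1 small = ∣p-q∣<ε (lower (√approx-below k q)) upper
    where
    r δ : ℚ
    r = √approx k q
    δ = step k
    0<ε : 0ℚ < ε
    0<ε = ℚ.<-trans (*-pos (ℚ.+-mono-< (ℚ.+-mono-< 0<A 0<A) (ℚ.positive⁻¹ 1ℚ)) (step-pos k)) small
    lower : r ≡ 0ℚ ⊎ r * r ℚ.≤ q → r * r < q + ε
    lower (inj₁ r≡0) = ≡.subst (λ p → p * p < q + ε) (≡.sym r≡0) (ℚ.+-mono-≤-< 0≤q 0<ε)
    lower (inj₂ r²≤q) = ≡.subst (_< q + ε) (ℚ.+-identityʳ (r * r)) (ℚ.+-mono-≤-< r²≤q 0<ε)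
    upper : q < r * r + ε
    upper = begin-strict
      q                              <⟨ √approx-above k q ⟩
      (r + δ) * (r + δ)              ≡⟨ solve 2 (λ r δ → (r :+ δ) :* (r :+ δ) := r :* r :+ (r :+ r :+ δ) :* δ) ≡.refl r δ ⟩
      r * r + (r + r + δ) * δ        ≤⟨ ℚ.+-monoʳ-≤ (r * r) (ℚ.*-monoʳ-≤-nonNeg δ {{ℚ.nonNegative (ℚ.<⇒≤ (step-pos k))}}
                                          (ℚ.+-mono-≤ (ℚ.+-mono-≤ r≤A r≤A) (ℚ.<⇒≤ δ<1))) ⟩
      r * r + (A + A + 1ℚ) * δ       <⟨ ℚ.+-monoʳ-< (r * r) small ⟩
      r * r + ε                      ∎

  -- Nonnegativity is asked of every term of the sequence, not of the limit; a sum of two squares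
  -- provides it in this form.
  √ᴿ-square : ∀ x → (∀ n → 0ℚ ℚ.≤ seq x n) → (√ᴿ x) *ᴿ (√ᴿ x) ≈ᴿ x
  √ᴿ-square x 0≤x = mk≈ᴿ λ ε 0<ε →
    let A , 0<A , N , r≤A = eventually-bounded (√ᴿ x)
        0<B               = ℚ.+-mono-< (ℚ.+-mono-< 0<A 0<A) (ℚ.positive⁻¹ 1ℚ)
        κ , 0<κ , Bκ≡ε    = scale 0<B 0<ε
        -- By `step-small`, the step 1/(n + 1) is below a positive rational once n reaches its
        -- denominator: `↧ₙ κ` serves for `κ`, and 1 for the bound `1ℚ`.
        K                 = ↧ₙ κ ℕ.⊔ 1
    in N ℕ.⊔ K , λ n N≤n →
      let K≤n = ℕ.m⊔n≤o⇒n≤o N K N≤n in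
      √approx-square {n} {seq x n} {A} {ε} (0≤x n) 0<A
        (ℚ.≤-trans (p≤∣p∣ (√approx n (seq x n))) (r≤A n (ℕ.m⊔n≤o⇒m≤o N K N≤n)))
        (step-small (ℚ.positive⁻¹ 1ℚ) n (ℕ.m⊔n≤o⇒n≤o (↧ₙ κ) 1 K≤n))
        (≡.subst ((A + A + 1ℚ) * step n <_) Bκ≡ε
          (ℚ.*-monoʳ-<-pos (A + A + 1ℚ) {{ℚ.positive 0<B}}
            (step-small 0<κ n (ℕ.m⊔n≤o⇒m≤o (↧ₙ κ) 1 K≤n))))

  -- The complex numbers as a commutative ring.

  ≈ᶜ-refl : ∀ {z} → z ≈ᶜ z
  ≈ᶜ-refl = mk≈ᶜ ≈ᴿ-refl ≈ᴿ-refl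

  -- Identities of complex numbers are checked on the rational approximations
  -- of the two coordinates.
  ≈ᶜ-pointwise : ∀ {z w} → (∀ n → seq (re z) n ≡ seq (re w) n) →
    (∀ n → seq (im z) n ≡ seq (im w) n) → z ≈ᶜ w
  ≈ᶜ-pointwise p q = mk≈ᶜ (pointwise p) (pointwise q)

  -ᶜ_ : ℂ → ℂ
  -ᶜ z = (-ᴿ re z) +i (-ᴿ im z)

  ℂ-isEquivalence : IsEquivalence _≈ᶜ_
  ℂ-isEquivalence = record
    { refl  = ≈ᶜ-refl
    ; sym   = λ { (mk≈ᶜ p q) → mk≈ᶜ (≈ᴿ-sym p) (≈ᴿ-sym q) }
    ; trans = λ { (mk≈ᶜ p q) (mk≈ᶜ p′ q′) → mk≈ᶜ (≈ᴿ-trans p p′) (≈ᴿ-trans q q′) }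
    }

  *ᶜ-cong : ∀ {z w u v} → z ≈ᶜ w → u ≈ᶜ v → z *ᶜ u ≈ᶜ w *ᶜ v
  *ᶜ-cong (mk≈ᶜ p q) (mk≈ᶜ p′ q′) = mk≈ᶜ
    (+ᴿ-cong (*ᴿ-cong p p′) (-ᴿ-cong (*ᴿ-cong q q′)))
    (+ᴿ-cong (*ᴿ-cong p q′) (*ᴿ-cong q p′))

  *ᶜ-assoc : ∀ x y z → (x *ᶜ y) *ᶜ z ≈ᶜ x *ᶜ (y *ᶜ z)
  *ᶜ-assoc x y z = ≈ᶜ-pointwise
    (λ n → solve 6 (λ a b c d e f →
        (a :* c :- b :* d) :* e :- (a :* d :+ b :* c) :* f :=
        a :* (c :* e :- d :* f) :- b :* (c :* f :+ d :* e)) ≡.refl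
      (seq (re x) n) (seq (im x) n) (seq (re y) n) (seq (im y) n) (seq (re z) n) (seq (im z) n))
    (λ n → solve 6 (λ a b c d e f →
        (a :* c :- b :* d) :* f :+ (a :* d :+ b :* c) :* e :=
        a :* (c :* f :+ d :* e) :+ b :* (c :* e :- d :* f)) ≡.refl
      (seq (re x) n) (seq (im x) n) (seq (re y) n) (seq (im y) n) (seq (re z) n) (seq (im z) n))

  *ᶜ-comm : ∀ x y → x *ᶜ y ≈ᶜ y *ᶜ x
  *ᶜ-comm x y = ≈ᶜ-pointwise
    (λ n → solve 4 (λ a b c d → a :* c :- b :* d := c :* a :- d :* b) ≡.refl
      (seq (re x) n) (seq (im x) n) (seq (re y) n) (seq (im y) n))
    (λ n → solve 4 (λ a b c d → a :* d :+ b :* c := c :* b :+ d :* a) ≡.refl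
      (seq (re x) n) (seq (im x) n) (seq (re y) n) (seq (im y) n))

  *ᶜ-identityˡ : ∀ x → 1ᶜ *ᶜ x ≈ᶜ x
  *ᶜ-identityˡ x = ≈ᶜ-pointwise
    (λ n → solve 2 (λ a b → con 1ℚ :* a :- con 0ℚ :* b := a) ≡.refl (seq (re x) n) (seq (im x) n))
    (λ n → solve 2 (λ a b → con 1ℚ :* b :+ con 0ℚ :* a := b) ≡.refl (seq (re x) n) (seq (im x) n))

  *ᶜ-distribˡ : ∀ x y z → x *ᶜ (y +ᶜ z) ≈ᶜ x *ᶜ y +ᶜ x *ᶜ z
  *ᶜ-distribˡ x y z = ≈ᶜ-pointwise
    (λ n → solve 6 (λ a b c d e f →
        a :* (c :+ e) :- b :* (d :+ f) := (a :* c :- b :* d) :+ (a :* e :- b :* f)) ≡.refl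
      (seq (re x) n) (seq (im x) n) (seq (re y) n) (seq (im y) n) (seq (re z) n) (seq (im z) n))
    (λ n → solve 6 (λ a b c d e f →
        a :* (d :+ f) :+ b :* (c :+ e) := (a :* d :+ b :* c) :+ (a :* f :+ b :* e)) ≡.refl
      (seq (re x) n) (seq (im x) n) (seq (re y) n) (seq (im y) n) (seq (re z) n) (seq (im z) n))

  *ᶜ-distribʳ : ∀ x y z → (y +ᶜ z) *ᶜ x ≈ᶜ y *ᶜ x +ᶜ z *ᶜ x
  *ᶜ-distribʳ x y z = ≈ᶜ-pointwise
    (λ n → solve 6 (λ a b c d e f →
        (c :+ e) :* a :- (d :+ f) :* b := (c :* a :- d :* b) :+ (e :* a :- f :* b)) ≡.refl
      (seq (re x) n) (seq (im x) n) (seq (re y) n) (seq (im y) n) (seq (re z) n) (seq (im z) n))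
    (λ n → solve 6 (λ a b c d e f →
        (c :+ e) :* b :+ (d :+ f) :* a := (c :* b :+ d :* a) :+ (e :* b :+ f :* a)) ≡.refl
      (seq (re x) n) (seq (im x) n) (seq (re y) n) (seq (im y) n) (seq (re z) n) (seq (im z) n))

  ℂ-isCommutativeRing : IsCommutativeRing _≈ᶜ_ _+ᶜ_ _*ᶜ_ -ᶜ_ 0ᶜ 1ᶜ
  ℂ-isCommutativeRing = record
    { isRing = record
      { +-isAbelianGroup = record
        { isGroup = record
          { isMonoid = record
            { isSemigroup = record
              { isMagma = record
                { isEquivalence = ℂ-isEquivalence
                ; ∙-cong        = λ { (mk≈ᶜ p q) (mk≈ᶜ p′ q′) → mk≈ᶜ (+ᴿ-cong p p′) (+ᴿ-cong q q′) }
                }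
              ; assoc = λ x y z → ≈ᶜ-pointwise
                  (λ n → ℚ.+-assoc (seq (re x) n) (seq (re y) n) (seq (re z) n))
                  (λ n → ℚ.+-assoc (seq (im x) n) (seq (im y) n) (seq (im z) n))
              }
            ; identity =
                (λ x → ≈ᶜ-pointwise (λ n → ℚ.+-identityˡ (seq (re x) n)) (λ n → ℚ.+-identityˡ (seq (im x) n)))
              , (λ x → ≈ᶜ-pointwise (λ n → ℚ.+-identityʳ (seq (re x) n)) (λ n → ℚ.+-identityʳ (seq (im x) n)))
            }
          ; inverse =
              (λ x → ≈ᶜ-pointwise (λ n → ℚ.+-inverseˡ (seq (re x) n)) (λ n → ℚ.+-inverseˡ (seq (im x) n)))
            , (λ x → ≈ᶜ-pointwise (λ n → ℚ.+-inverseʳ (seq (re x) n)) (λ n → ℚ.+-inverseʳ (seq (im x) n)))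
          ; ⁻¹-cong = λ { (mk≈ᶜ p q) → mk≈ᶜ (-ᴿ-cong p) (-ᴿ-cong q) }
          }
        ; comm = λ x y → ≈ᶜ-pointwise
            (λ n → ℚ.+-comm (seq (re x) n) (seq (re y) n))
            (λ n → ℚ.+-comm (seq (im x) n) (seq (im y) n))
        }
      ; *-cong     = *ᶜ-cong
      ; *-assoc    = *ᶜ-assoc
      ; *-identity = *ᶜ-identityˡ
                   , λ x → IsEquivalence.trans ℂ-isEquivalence (*ᶜ-comm x 1ᶜ) (*ᶜ-identityˡ x)
      ; distrib    = *ᶜ-distribˡ , *ᶜ-distribʳ
      }
    ; *-comm = *ᶜ-comm
    }

  -- Conjugation, the embedding of ℚ, and the modulus.

  conj-* : ∀ z w → conj (z *ᶜ w) ≈ᶜ conj z *ᶜ conj w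
  conj-* z w = ≈ᶜ-pointwise
    (λ n → solve 4 (λ a b c d → a :* c :- b :* d := a :* c :- :- b :* :- d) ≡.refl
      (seq (re z) n) (seq (im z) n) (seq (re w) n) (seq (im w) n))
    (λ n → solve 4 (λ a b c d → :- (a :* d :+ b :* c) := a :* :- d :+ :- b :* c) ≡.refl
      (seq (re z) n) (seq (im z) n) (seq (re w) n) (seq (im w) n))

  conj-+ : ∀ z w → conj (z +ᶜ w) ≈ᶜ conj z +ᶜ conj w
  conj-+ z w = ≈ᶜ-pointwise (λ n → ≡.refl)
    (λ n → ℚ.neg-distrib-+ (seq (im z) n) (seq (im w) n))

  conj-involutive : ∀ z → conj (conj z) ≈ᶜ z
  conj-involutive z = ≈ᶜ-pointwise (λ n → ≡.refl) (λ n → solve 1 (λ b → :- :- b := b) ≡.refl (seq (im z) n))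

  conj-cong : ∀ {z w} → z ≈ᶜ w → conj z ≈ᶜ conj w
  conj-cong (mk≈ᶜ p q) = mk≈ᶜ p (-ᴿ-cong q)

  ι : ℚ → ℂ
  ι q = fromℚ q +i 0ᴿ

  ι-+ : ∀ p q → ι (p + q) ≈ᶜ ι p +ᶜ ι q
  ι-+ p q = ≈ᶜ-pointwise (λ _ → ≡.refl) (λ _ → ≡.refl)

  ι-* : ∀ p q → ι (p * q) ≈ᶜ ι p *ᶜ ι q
  ι-* p q = ≈ᶜ-pointwise
    (λ _ → solve 2 (λ p q → p :* q := p :* q :- con 0ℚ :* con 0ℚ) ≡.refl p q)
    (λ _ → solve 2 (λ p q → con 0ℚ := p :* con 0ℚ :+ con 0ℚ :* q) ≡.refl p q)

  conj-ι : ∀ q → conj (ι q) ≈ᶜ ι q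
  conj-ι q = ≈ᶜ-pointwise (λ _ → ≡.refl) (λ _ → ≡.refl)

  0≤p*p : ∀ p → 0ℚ ℚ.≤ p * p
  0≤p*p p with ℚ.≤-total 0ℚ p
  ... | inj₁ 0≤p = ℚ.nonNegative⁻¹ _ {{ℚ.nonNeg*nonNeg⇒nonNeg p {{ℚ.nonNegative 0≤p}} p {{ℚ.nonNegative 0≤p}}}}
  ... | inj₂ p≤0 = ℚ.nonNegative⁻¹ _ {{ℚ.nonPos*nonPos⇒nonPos p {{ℚ.nonPositive p≤0}} p {{ℚ.nonPositive p≤0}}}}

  -- Removes the square root hidden in the modulus: unbiasedness speaks of `∣ z ∣ᶜ`, while traces
  -- produce `z *ᶜ conj z`.
  ∣∣ᶜ-square : ∀ z {c} → ∣ z ∣ᶜ ≈ᴿ c → z *ᶜ conj z ≈ᶜ (c *ᴿ c) +i 0ᴿ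
  ∣∣ᶜ-square z {c} ∣z∣≈c = mk≈ᶜ
    (≈ᴿ-trans {y = normSq} (pointwise λ n → solve 2 (λ a b → a :* a :- b :* :- b := a :* a :+ b :* b) ≡.refl
        (seq (re z) n) (seq (im z) n))
      (≈ᴿ-trans (≈ᴿ-sym (√ᴿ-square normSq λ n → ℚ.+-mono-≤ (0≤p*p (seq (re z) n)) (0≤p*p (seq (im z) n))))
        (*ᴿ-cong ∣z∣≈c ∣z∣≈c)))
    (pointwise λ n → solve 2 (λ a b → a :* :- b :+ b :* a := con 0ℚ) ≡.refl (seq (re z) n) (seq (im z) n))
    where
    normSq : ℝ
    normSq = re z *ᴿ re z +ᴿ im z *ᴿ im z

ℂ-commutativeRing : CommutativeRing 0ℓ 0ℓ
ℂ-commutativeRing = record { isCommutativeRing = ℂ-isCommutativeRing }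

-- An orthogonal basis of ℚⁿ containing (1,...,1).

module Helmert where
  open import Data.Rational.Base using (_+_; _*_; -_; _<_)
  open SemiringSum (CommutativeRing.semiring ℚ.+-*-commutativeRing) public
    using () renaming (sum to sumℚ; sum-cong-≗ to sumℚ-cong)

  -- Up to order and scaling these are the rows of the Helmert matrix,
  -- (1,…,1) and (0,…,0,−r,1,…,1) with r trailing ones.
  helmert : ∀ {n} → Fin n → Vector ℚ n
  helmert zero    _       = 1ℚ
  helmert (suc t) zero    = - sumℚ (helmert t)
  helmert (suc t) (suc a) = helmert t a

  sum-helmert-suc : ∀ {n} (t : Fin n) → sumℚ (helmert (suc t)) ≡ 0ℚ
  sum-helmert-suc t = ℚ.+-inverseˡ (sumℚ (helmert t))

  -- The row (1 - n, 1, ..., 1), available from dimension 2 on; it supplies the matrix that tells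
  -- two classes apart.
  sum-helmert-zero : ∀ {n} → 2 ≤ n → ∃ λ (s : Fin n) → sumℚ (helmert s) ≡ 0ℚ
  sum-helmert-zero {suc (suc n)} (ℕ.s≤s (ℕ.s≤s _)) = suc zero , sum-helmert-suc {suc n} zero

  sum-helmert-≡0⊎helmert-≡1 : ∀ {n} (s : Fin n) → sumℚ (helmert s) ≡ 0ℚ ⊎ (∀ a → helmert s a ≡ 1ℚ)
  sum-helmert-≡0⊎helmert-≡1 zero    = inj₂ λ _ → ≡.refl
  sum-helmert-≡0⊎helmert-≡1 (suc s) = inj₁ (sum-helmert-suc s)

  sum-helmert-≢ : ∀ {n} (s t : Fin n) → s ≢ t → sumℚ (helmert s) ≡ 0ℚ ⊎ sumℚ (helmert t) ≡ 0ℚ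
  sum-helmert-≢ zero    zero    s≢t = contradiction ≡.refl s≢t
  sum-helmert-≢ zero    (suc t) _   = inj₂ (sum-helmert-suc t)
  sum-helmert-≢ (suc s) t       _   = inj₁ (sum-helmert-suc s)

  gram : ∀ {n} → Fin n → Fin n → ℚ
  gram s t = sumℚ λ a → helmert s a * helmert t a

  -- Induction on the dimension. The first coordinates of two later rows contribute the product of
  -- the sums of the shorter rows, which vanishes because at most one row has nonzero sum; what
  -- remains is the inner product of the shorter rows.
  gram-≢ : ∀ {n} (s t : Fin n) → s ≢ t → gram s t ≡ 0ℚ
  gram-≢ zero    zero    s≢t = contradiction ≡.refl s≢t
  gram-≢ zero    (suc t) _   =
    ≡.trans (sumℚ-cong λ a → ℚ.*-identityˡ (helmert (suc t) a)) (sum-helmert-suc t)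
  gram-≢ (suc s) zero    _   =
    ≡.trans (sumℚ-cong λ a → ℚ.*-identityʳ (helmert (suc s) a)) (sum-helmert-suc s)
  gram-≢ (suc s) (suc t) s≢t = ≡.cong₂ _+_ (head-≡0 (sum-helmert-≢ s t s≢t′)) (gram-≢ s t s≢t′)
    where
    s≢t′ : s ≢ t
    s≢t′ = s≢t ∘ ≡.cong suc
    head-≡0 : sumℚ (helmert s) ≡ 0ℚ ⊎ sumℚ (helmert t) ≡ 0ℚ →
      - sumℚ (helmert s) * - sumℚ (helmert t) ≡ 0ℚ
    head-≡0 (inj₁ S≡0) = ≡.trans (≡.cong (λ p → - p * - sumℚ (helmert t)) S≡0) (ℚ.*-zeroˡ (- sumℚ (helmert t)))
    head-≡0 (inj₂ T≡0) = ≡.trans (≡.cong (λ p → - sumℚ (helmert s) * - p) T≡0) (ℚ.*-zeroʳ (- sumℚ (helmert s)))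

  sum-squares-nonneg : ∀ {n} (f : Vector ℚ n) → 0ℚ ℚ.≤ sumℚ λ a → f a * f a
  sum-squares-nonneg {zero}  f = ℚ.≤-refl
  sum-squares-nonneg {suc n} f = ℚ.+-mono-≤ (0≤p*p (f zero)) (sum-squares-nonneg (f ∘ suc))

  -- Stripping first coordinates leads to a row of ones, whose leading entry contributes 1; every
  -- other contribution is a square.
  gram-positive : ∀ {n} (s : Fin n) → 0ℚ < gram s s
  gram-positive {suc n} zero = ℚ.+-mono-<-≤ (ℚ.positive⁻¹ (1ℚ * 1ℚ)) (sum-squares-nonneg {n} (const 1ℚ))
  gram-positive (suc s)      = ℚ.+-mono-≤-< (0≤p*p (- sumℚ (helmert s))) (gram-positive s)

open Helmert
open CommutativeRing ℂ-commutativeRing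
  using (setoid; semiring; +-cong; *-cong; *-congˡ; *-congʳ; *-identityˡ; *-identityʳ; *-comm; *-assoc
        ; zeroˡ; zeroʳ; +-identityʳ; *-commutativeMonoid) renaming (reflexive to ≈-reflexive; refl to ≈-refl; sym to ≈-sym; trans to ≈-trans)
open SemiringSum semiring using (sum-cong-≋; sum-remove; sum-replicate-zero; ∑-comm; *-distribˡ-sum; *-distribʳ-sum)
open SetoidReasoning setoid
module ∗ = CommutativeMonoidSolver *-commutativeMonoid

-- Finite sums and the inner product.

sum-zero : ∀ {n} {f : Vector ℂ n} → (∀ i → f i ≈ᶜ 0ᶜ) → sum f ≈ᶜ 0ᶜ
sum-zero {n} f≈0 = ≈-trans (sum-cong-≋ f≈0) (sum-replicate-zero n)

sum-single : ∀ {n} (f : Vector ℂ n) i → (∀ j → j ≢ i → f j ≈ᶜ 0ᶜ) → sum f ≈ᶜ f i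
sum-single {suc n} f i f≈0 = begin
  sum f                                ≈⟨ sum-remove f ⟩
  f i +ᶜ sum (λ j → f (punchIn i j))   ≈⟨ +-cong ≈-refl (sum-zero λ j → f≈0 (punchIn i j) (punchInᵢ≢i i j)) ⟩
  f i +ᶜ 0ᶜ                            ≈⟨ +-identityʳ (f i) ⟩
  f i                                  ∎

sum-*-sum : ∀ {k l} (f : Vector ℂ k) (g : Vector ℂ l) →
  sum f *ᶜ sum g ≈ᶜ sum λ x → sum λ y → f x *ᶜ g y
sum-*-sum f g = ≈-trans (*-distribʳ-sum (sum g) f) (sum-cong-≋ λ x → *-distribˡ-sum (f x) g)

conj-sum : ∀ {n} (f : Vector ℂ n) → conj (sum f) ≈ᶜ sum (conj ∘ f)
conj-sum {zero}  f = conj-ι 0ℚ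
conj-sum {suc n} f = ≈-trans (conj-+ (f zero) (sum (f ∘ suc))) (+-cong ≈-refl (conj-sum (f ∘ suc)))

ι-sum : ∀ {n} (f : Vector ℚ n) → ι (sumℚ f) ≈ᶜ sum (ι ∘ f)
ι-sum {zero}  f = ≈-refl
ι-sum {suc n} f = ≈-trans (ι-+ (f zero) (sumℚ (f ∘ suc))) (+-cong ≈-refl (ι-sum (f ∘ suc)))

⟨⟩-conj : ∀ {n} (u v : Vector ℂ n) → ⟨ v , u ⟩ ≈ᶜ conj ⟨ u , v ⟩
⟨⟩-conj u v = ≈-sym (≈-trans (conj-sum λ i → conj (u i) *ᶜ v i) (sum-cong-≋ λ i → begin
  conj (conj (u i) *ᶜ v i)        ≈⟨ conj-* (conj (u i)) (v i) ⟩
  conj (conj (u i)) *ᶜ conj (v i) ≈⟨ *-congʳ (conj-involutive (u i)) ⟩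
  u i *ᶜ conj (v i)               ≈⟨ *-comm (u i) (conj (v i)) ⟩
  conj (v i) *ᶜ u i               ∎))

unit : ∀ {n} → Fin n → Vector ℂ n
unit j = updateAt 0ᵛ j (const 1ᶜ)

⟨⟩-unit : ∀ {n} (u : Vector ℂ n) j → ⟨ u , unit j ⟩ ≈ᶜ conj (u j)
⟨⟩-unit u j = begin
  ⟨ u , unit j ⟩           ≈⟨ sum-single _ j (λ p p≢j → ≈-trans (*-congˡ (≈-reflexive (updateAt-minimal p j 0ᵛ p≢j))) (zeroʳ (conj (u p)))) ⟩
  conj (u j) *ᶜ unit j j   ≈⟨ *-congˡ (≈-reflexive (updateAt-updates j 0ᵛ)) ⟩
  conj (u j) *ᶜ 1ᶜ         ≈⟨ *-identityʳ (conj (u j)) ⟩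
  conj (u j)               ∎

-- Compatibility of the matrix operations with entrywise equality.

·-cong : ∀ {n} {A A′ B B′ : Matrix n} → A ≈ᴹ A′ → B ≈ᴹ B′ → A · B ≈ᴹ A′ · B′
·-cong A≈A′ B≈B′ i j = sum-cong-≋ λ k → *-cong (A≈A′ i k) (B≈B′ k j)

†-cong : ∀ {n} {A B : Matrix n} → A ≈ᴹ B → A † ≈ᴹ B †
†-cong A≈B i j = conj-cong (A≈B j i)

≈ᴹ-sym : ∀ {n} {A B : Matrix n} → A ≈ᴹ B → B ≈ᴹ A
≈ᴹ-sym A≈B i j = ≈-sym (A≈B i j)

≈ᴹ-trans : ∀ {n} {A B D : Matrix n} → A ≈ᴹ B → B ≈ᴹ D → A ≈ᴹ D
≈ᴹ-trans A≈B B≈D i j = ≈-trans (A≈B i j) (B≈D i j)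

tr-cong : ∀ {n} {A B : Matrix n} → A ≈ᴹ B → tr A ≈ᶜ tr B
tr-cong A≈B = sum-cong-≋ λ i → A≈B i i

Orthogonal-resp : ∀ {n} {A A′ B B′ : Matrix n} → A ≈ᴹ A′ → B ≈ᴹ B′ → Orthogonal A B → Orthogonal A′ B′
Orthogonal-resp A≈A′ B≈B′ A⊥B =
  ≈-trans (≈-sym (tr-cong (·-cong (†-cong A≈A′) B≈B′))) A⊥B

-- Combinations of rank-one matrices: products, traces, adjoints.

-- ∑ₓ cₓ ∣bₓ⟩⟨bₓ∣
spectral : ∀ {n} → Vector ℂ n → Vector (Vector ℂ n) n → Matrix n
spectral c b i j = sum λ x → c x *ᶜ (b x i *ᶜ conj (b x j))

module _ {n} (c d : Vector ℂ n) (a b : Vector (Vector ℂ n) n) where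

  -- Each pair of rank-one terms multiplies as ∣aₓ⟩⟨aₓ,bᵧ⟩⟨bᵧ∣: moving the summation index `k` of
  -- the matrix product innermost assembles the inner product.
  spectral-· : ∀ i j → (spectral c a · spectral d b) i j ≈ᶜ
    sum λ x → sum λ y → ⟨ a x , b y ⟩ *ᶜ ((c x *ᶜ d y) *ᶜ (a x i *ᶜ conj (b y j)))
  spectral-· i j = begin
    (sum λ k → spectral c a i k *ᶜ spectral d b k j)         ≈⟨ sum-cong-≋ (λ k → sum-*-sum (left k) (right k)) ⟩
    (sum λ k → sum λ x → sum λ y → left k x *ᶜ right k y)    ≈⟨ ∑-comm (λ k x → sum λ y → left k x *ᶜ right k y) ⟩
    (sum λ x → sum λ k → sum λ y → left k x *ᶜ right k y)    ≈⟨ sum-cong-≋ (λ x → ∑-comm (λ k y → left k x *ᶜ right k y)) ⟩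
    (sum λ x → sum λ y → sum λ k → left k x *ᶜ right k y)    ≈⟨ sum-cong-≋ (λ x → sum-cong-≋ (collect x)) ⟩
    (sum λ x → sum λ y → ⟨ a x , b y ⟩ *ᶜ ((c x *ᶜ d y) *ᶜ (a x i *ᶜ conj (b y j))))  ∎
    where
    left right : Fin n → Vector ℂ n
    left  k x = c x *ᶜ (a x i *ᶜ conj (a x k))
    right k y = d y *ᶜ (b y k *ᶜ conj (b y j))
    collect : ∀ x y → (sum λ k → left k x *ᶜ right k y) ≈ᶜ ⟨ a x , b y ⟩ *ᶜ ((c x *ᶜ d y) *ᶜ (a x i *ᶜ conj (b y j)))
    collect x y = ≈-trans
      (sum-cong-≋ λ k → ∗.solve 6 (λ c d a ā b b̄ → ((c ∗.⊕ (a ∗.⊕ ā)) ∗.⊕ (d ∗.⊕ (b ∗.⊕ b̄))) ∗.⊜ ((ā ∗.⊕ b) ∗.⊕ ((c ∗.⊕ d) ∗.⊕ (a ∗.⊕ b̄)))) ≈-refl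
        (c x) (d y) (a x i) (conj (a x k)) (b y k) (conj (b y j)))
      (≈-sym (*-distribʳ-sum ((c x *ᶜ d y) *ᶜ (a x i *ᶜ conj (b y j))) (λ k → conj (a x k) *ᶜ b y k)))

  -- Summing over the diagonal assembles `⟨ b y , a x ⟩`, the conjugate of the factor already
  -- present, so each pair is weighted by a squared modulus.
  tr-spectral-· : tr (spectral c a · spectral d b) ≈ᶜ
    sum λ x → sum λ y → (c x *ᶜ d y) *ᶜ (⟨ a x , b y ⟩ *ᶜ conj ⟨ a x , b y ⟩)
  tr-spectral-· = begin
    (sum λ i → (spectral c a · spectral d b) i i)     ≈⟨ sum-cong-≋ (λ i → spectral-· i i) ⟩
    (sum λ i → sum λ x → sum λ y → term x y i)        ≈⟨ ∑-comm (λ i x → sum λ y → term x y i) ⟩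
    (sum λ x → sum λ i → sum λ y → term x y i)        ≈⟨ sum-cong-≋ (λ x → ∑-comm (λ i y → term x y i)) ⟩
    (sum λ x → sum λ y → sum λ i → term x y i)        ≈⟨ sum-cong-≋ (λ x → sum-cong-≋ (collect x)) ⟩
    (sum λ x → sum λ y → (c x *ᶜ d y) *ᶜ (⟨ a x , b y ⟩ *ᶜ conj ⟨ a x , b y ⟩))  ∎
    where
    term : Fin n → Fin n → Fin n → ℂ
    term x y i = ⟨ a x , b y ⟩ *ᶜ ((c x *ᶜ d y) *ᶜ (a x i *ᶜ conj (b y i)))
    collect : ∀ x y → sum (term x y) ≈ᶜ (c x *ᶜ d y) *ᶜ (⟨ a x , b y ⟩ *ᶜ conj ⟨ a x , b y ⟩)
    collect x y = begin
      sum (term x y)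
        ≈⟨ sum-cong-≋ (λ i → ∗.solve 4 (λ z q a b̄ → (z ∗.⊕ (q ∗.⊕ (a ∗.⊕ b̄))) ∗.⊜ ((q ∗.⊕ z) ∗.⊕ (b̄ ∗.⊕ a))) ≈-refl
             ⟨ a x , b y ⟩ (c x *ᶜ d y) (a x i) (conj (b y i))) ⟩
      (sum λ i → ((c x *ᶜ d y) *ᶜ ⟨ a x , b y ⟩) *ᶜ (conj (b y i) *ᶜ a x i))
        ≈⟨ ≈-sym (*-distribˡ-sum ((c x *ᶜ d y) *ᶜ ⟨ a x , b y ⟩) (λ i → conj (b y i) *ᶜ a x i)) ⟩
      ((c x *ᶜ d y) *ᶜ ⟨ a x , b y ⟩) *ᶜ ⟨ b y , a x ⟩
        ≈⟨ *-congˡ (⟨⟩-conj (a x) (b y)) ⟩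
      ((c x *ᶜ d y) *ᶜ ⟨ a x , b y ⟩) *ᶜ conj ⟨ a x , b y ⟩
        ≈⟨ *-assoc (c x *ᶜ d y) ⟨ a x , b y ⟩ (conj ⟨ a x , b y ⟩) ⟩
      (c x *ᶜ d y) *ᶜ (⟨ a x , b y ⟩ *ᶜ conj ⟨ a x , b y ⟩)  ∎

-- Rational coefficients are fixed by conjugation, and each ∣bₓ⟩⟨bₓ∣ is Hermitian.
spectral-† : ∀ {n} (q : Vector ℚ n) b → spectral (ι ∘ q) b † ≈ᴹ spectral (ι ∘ q) b
spectral-† q b i j = ≈-trans (conj-sum λ x → ι (q x) *ᶜ (b x j *ᶜ conj (b x i))) (sum-cong-≋ λ x → begin
  conj (ι (q x) *ᶜ (b x j *ᶜ conj (b x i)))               ≈⟨ conj-* (ι (q x)) (b x j *ᶜ conj (b x i)) ⟩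
  conj (ι (q x)) *ᶜ conj (b x j *ᶜ conj (b x i))          ≈⟨ *-cong (conj-ι (q x)) (conj-* (b x j) (conj (b x i))) ⟩
  ι (q x) *ᶜ (conj (b x j) *ᶜ conj (conj (b x i)))        ≈⟨ *-congˡ (*-congˡ (conj-involutive (b x i))) ⟩
  ι (q x) *ᶜ (conj (b x j) *ᶜ b x i)                      ≈⟨ *-congˡ (*-comm (conj (b x j)) (b x i)) ⟩
  ι (q x) *ᶜ (b x i *ᶜ conj (b x j))                      ∎)

module _ {n} {b : Vector (Vector ℂ n) n} (onb : IsOrthonormalBasis b) where
  open IsOrthonormalBasis onb

  -- The ∣bₓ⟩⟨bₓ∣ are idempotent and annihilate each other, so only the diagonal terms survive.
  -- Commutation of the matrices thus reduces to commutation of their coefficients.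
  spectral-·-onb : ∀ c d → spectral c b · spectral d b ≈ᴹ spectral (λ x → c x *ᶜ d x) b
  spectral-·-onb c d i j = ≈-trans (spectral-· c d b b i j) (sum-cong-≋ λ x → ≈-trans
    (sum-single (λ y → ⟨ b x , b y ⟩ *ᶜ ((c x *ᶜ d y) *ᶜ (b x i *ᶜ conj (b y j)))) x
      λ y y≢x → ≈-trans (*-congʳ (orthogonal x y (y≢x ∘ ≡.sym))) (zeroˡ _))
    (≈-trans (*-congʳ (normalised x)) (*-identityˡ _)))

  spectral-comm : ∀ c d → spectral c b · spectral d b ≈ᴹ spectral d b · spectral c b
  spectral-comm c d i j = begin
    (spectral c b · spectral d b) i j        ≈⟨ spectral-·-onb c d i j ⟩
    spectral (λ x → c x *ᶜ d x) b i j        ≈⟨ sum-cong-≋ (λ x → *-congʳ (*-comm (c x) (d x))) ⟩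
    spectral (λ x → d x *ᶜ c x) b i j        ≈⟨ spectral-·-onb d c i j ⟨
    (spectral d b · spectral c b) i j        ∎

  tr-spectral-·-onb : ∀ c d → tr (spectral c b · spectral d b) ≈ᶜ sum λ x → c x *ᶜ d x
  tr-spectral-·-onb c d = ≈-trans (tr-spectral-· c d b b) (sum-cong-≋ λ x → ≈-trans
    (sum-single (λ y → (c x *ᶜ d y) *ᶜ (⟨ b x , b y ⟩ *ᶜ conj ⟨ b x , b y ⟩)) x
      λ y y≢x → ≈-trans (*-congˡ (≈-trans (*-congʳ (orthogonal x y (y≢x ∘ ≡.sym))) (zeroˡ _))) (zeroʳ _))
    (≈-trans (*-congˡ (≈-trans (*-cong (normalised x) (≈-trans (conj-cong (normalised x)) (conj-ι 1ℚ))) (*-identityˡ 1ᶜ)))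
      (*-identityʳ _)))

  -- Pairing the expansion with `b i` leaves the single term x = i. This identifies the otherwise
  -- unknown coefficients that `spanning` returns.
  coefficient : ∀ c v → combination c b ≈ᵛ v → ∀ i → c i ≈ᶜ ⟨ b i , v ⟩
  coefficient c v cb≈v i = ≈-sym (begin
    (sum λ p → conj (b i p) *ᶜ v p)                                 ≈⟨ sum-cong-≋ (λ p → *-congˡ (cb≈v p)) ⟨
    (sum λ p → conj (b i p) *ᶜ combination c b p)                   ≈⟨ sum-cong-≋ (λ p → *-distribˡ-sum (conj (b i p)) (λ x → c x *ᶜ b x p)) ⟩
    (sum λ p → sum λ x → conj (b i p) *ᶜ (c x *ᶜ b x p))            ≈⟨ ∑-comm (λ p x → conj (b i p) *ᶜ (c x *ᶜ b x p)) ⟩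
    (sum λ x → sum λ p → conj (b i p) *ᶜ (c x *ᶜ b x p))            ≈⟨ sum-cong-≋ factor ⟩
    (sum λ x → c x *ᶜ ⟨ b i , b x ⟩)                                ≈⟨ sum-single _ i (λ x x≢i → ≈-trans (*-congˡ (orthogonal i x (x≢i ∘ ≡.sym))) (zeroʳ (c x))) ⟩
    c i *ᶜ ⟨ b i , b i ⟩                                            ≈⟨ *-congˡ (normalised i) ⟩
    c i *ᶜ 1ᶜ                                                       ≈⟨ *-identityʳ (c i) ⟩
    c i                                                             ∎)
    where
    factor : ∀ x → (sum λ p → conj (b i p) *ᶜ (c x *ᶜ b x p)) ≈ᶜ c x *ᶜ ⟨ b i , b x ⟩
    factor x = ≈-trans
      (sum-cong-≋ λ p → ∗.solve 3 (λ ā c b → (ā ∗.⊕ (c ∗.⊕ b)) ∗.⊜ (c ∗.⊕ (ā ∗.⊕ b))) ≈-refl (conj (b i p)) (c x) (b x p))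
      (≈-sym (*-distribˡ-sum (c x) (λ p → conj (b i p) *ᶜ b x p)))

  -- Column `j` of the sum of projections is the expansion of `unit j` in the basis, with
  -- coefficients `conj (b x j)`; completeness enters through `spanning`.
  resolution-of-identity : spectral (const 1ᶜ) b ≈ᴹ λ i j → unit j i
  resolution-of-identity i j with c , cb≈e ← spanning (unit j) = begin
    (sum λ x → 1ᶜ *ᶜ (b x i *ᶜ conj (b x j)))   ≈⟨ sum-cong-≋ (λ x → *-identityˡ (b x i *ᶜ conj (b x j))) ⟩
    (sum λ x → b x i *ᶜ conj (b x j))           ≈⟨ sum-cong-≋ (λ x → *-comm (b x i) (conj (b x j))) ⟩
    (sum λ x → conj (b x j) *ᶜ b x i)           ≈⟨ sum-cong-≋ (λ x → *-congʳ (≈-trans (coefficient c (unit j) cb≈e x) (⟨⟩-unit (b x) j))) ⟨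
    combination c b i                           ≈⟨ cb≈e i ⟩
    unit j i                                    ∎

-- All pairs carry the same squared modulus, so it factors out and the double sum separates into a
-- product of coefficient sums.
tr-spectral-·-unbiased : ∀ {n} .{{_ : NonZero n}} {a b : Vector (Vector ℂ n) n} → Unbiased a b → ∀ c d →
  tr (spectral c a · spectral d b) ≈ᶜ (sum c *ᶜ sum d) *ᶜ ((1/√ n *ᴿ 1/√ n) +i 0ᴿ)
tr-spectral-·-unbiased {n} {a} {b} ab c d = begin
  tr (spectral c a · spectral d b)
    ≈⟨ tr-spectral-· c d a b ⟩
  (sum λ x → sum λ y → (c x *ᶜ d y) *ᶜ (⟨ a x , b y ⟩ *ᶜ conj ⟨ a x , b y ⟩))
    ≈⟨ sum-cong-≋ (λ x → sum-cong-≋ λ y → *-congˡ (∣∣ᶜ-square ⟨ a x , b y ⟩ (ab x y))) ⟩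
  (sum λ x → sum λ y → (c x *ᶜ d y) *ᶜ κ)
    ≈⟨ sum-cong-≋ (λ x → *-distribʳ-sum κ (λ y → c x *ᶜ d y)) ⟨
  (sum λ x → (sum λ y → c x *ᶜ d y) *ᶜ κ)
    ≈⟨ *-distribʳ-sum κ (λ x → sum λ y → c x *ᶜ d y) ⟨
  (sum λ x → sum λ y → c x *ᶜ d y) *ᶜ κ
    ≈⟨ *-congʳ (sum-*-sum c d) ⟨
  (sum c *ᶜ sum d) *ᶜ κ  ∎
  where
  κ : ℂ
  κ = (1/√ n *ᴿ 1/√ n) +i 0ᴿ

-- The class matrices and their classes.

classMatrix : ∀ {n} → Vector (Vector ℂ n) n → Fin n → Matrix n
classMatrix b t = spectral (ι ∘ helmert t) b

tr-classMatrix : ∀ {n} (a b : Vector (Vector ℂ n) n) s t →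
  tr (classMatrix a s † · classMatrix b t) ≈ᶜ tr (classMatrix a s · classMatrix b t)
tr-classMatrix a b s t = tr-cong (·-cong (spectral-† (helmert s) a) λ _ _ → ≈-refl)

classMatrix-gram : ∀ {n} {b : Vector (Vector ℂ n) n} → IsOrthonormalBasis b → ∀ s t →
  tr (classMatrix b s † · classMatrix b t) ≈ᶜ ι (gram s t)
classMatrix-gram {b = b} onb s t = begin
  tr (classMatrix b s † · classMatrix b t)          ≈⟨ tr-classMatrix b b s t ⟩
  tr (classMatrix b s · classMatrix b t)            ≈⟨ tr-spectral-·-onb onb (ι ∘ helmert s) (ι ∘ helmert t) ⟩
  (sum λ x → ι (helmert s x) *ᶜ ι (helmert t x))    ≈⟨ sum-cong-≋ (λ x → ι-* (helmert s x) (helmert t x)) ⟨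
  (sum λ x → ι (helmert s x ℚ.* helmert t x))       ≈⟨ ι-sum (λ x → helmert s x ℚ.* helmert t x) ⟨
  ι (gram s t)                                      ∎

-- The squared norm is a positive rational. Matrices are told apart by this: two equal ones that
-- were orthogonal would be self-orthogonal.
classMatrix-¬self-orthogonal : ∀ {n} {b : Vector (Vector ℂ n) n} → IsOrthonormalBasis b → ∀ s →
  ¬ Orthogonal (classMatrix b s) (classMatrix b s)
classMatrix-¬self-orthogonal onb s A⊥A = ℚ.<-irrefl
  (≡.sym (fromℚ-≈0 (_≈ᶜ_.re-≈ (≈-trans (≈-sym (classMatrix-gram onb s s)) A⊥A)))) (gram-positive s)

classMatrix-orthogonal : ∀ {n} {b : Vector (Vector ℂ n) n} → IsOrthonormalBasis b → ∀ s t → s ≢ t →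
  Orthogonal (classMatrix b s) (classMatrix b t)
classMatrix-orthogonal onb s t s≢t =
  ≈-trans (classMatrix-gram onb s t) (≈-reflexive (≡.cong ι (gram-≢ s t s≢t)))

classMatrix-cross-orthogonal : ∀ {n} .{{_ : NonZero n}} {a b : Vector (Vector ℂ n) n} → Unbiased a b → ∀ s t →
  sumℚ (helmert s) ≡ 0ℚ ⊎ sumℚ (helmert t) ≡ 0ℚ → Orthogonal (classMatrix a s) (classMatrix b t)
classMatrix-cross-orthogonal {a = a} {b} ab s t ST≡0 = begin
  tr (classMatrix a s † · classMatrix b t)               ≈⟨ tr-classMatrix a b s t ⟩
  tr (classMatrix a s · classMatrix b t)                 ≈⟨ tr-spectral-·-unbiased ab (ι ∘ helmert s) (ι ∘ helmert t) ⟩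
  (sum (ι ∘ helmert s) *ᶜ sum (ι ∘ helmert t)) *ᶜ _      ≈⟨ *-congʳ (product ST≡0) ⟩
  0ᶜ *ᶜ _                                                ≈⟨ zeroˡ _ ⟩
  0ᶜ                                                     ∎
  where
  vanish : ∀ r → sumℚ (helmert r) ≡ 0ℚ → sum (ι ∘ helmert r) ≈ᶜ 0ᶜ
  vanish r S≡0 = ≈-trans (≈-sym (ι-sum (helmert r))) (≈-reflexive (≡.cong ι S≡0))
  product : sumℚ (helmert s) ≡ 0ℚ ⊎ sumℚ (helmert t) ≡ 0ℚ → sum (ι ∘ helmert s) *ᶜ sum (ι ∘ helmert t) ≈ᶜ 0ᶜ
  product (inj₁ S≡0) = ≈-trans (*-congʳ (vanish s S≡0)) (zeroˡ (sum (ι ∘ helmert t)))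
  product (inj₂ T≡0) = ≈-trans (*-congˡ (vanish t T≡0)) (zeroʳ (sum (ι ∘ helmert s)))

classMatrix-identity : ∀ {n} {b : Vector (Vector ℂ n) n} → IsOrthonormalBasis b → ∀ s →
  (∀ x → helmert s x ≡ 1ℚ) → classMatrix b s ≈ᴹ λ i j → unit j i
classMatrix-identity onb s s≡1 i j = ≈-trans
  (sum-cong-≋ λ x → *-congʳ (≈-reflexive (≡.cong ι (s≡1 x)))) (resolution-of-identity onb i j)

classMatrix-cross : ∀ {n} .{{_ : NonZero n}} {a b : Vector (Vector ℂ n) n} →
  IsOrthonormalBasis a → IsOrthonormalBasis b → Unbiased a b → ∀ s t →
  ¬ classMatrix a s ≈ᴹ classMatrix b t → Orthogonal (classMatrix a s) (classMatrix b t)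
classMatrix-cross {a = a} {b} onbᵃ onbᵇ ab s t A≉B =
  cases (sum-helmert-≡0⊎helmert-≡1 s) (sum-helmert-≡0⊎helmert-≡1 t)
  where
  cases : sumℚ (helmert s) ≡ 0ℚ ⊎ (∀ x → helmert s x ≡ 1ℚ) → sumℚ (helmert t) ≡ 0ℚ ⊎ (∀ x → helmert t x ≡ 1ℚ) →
    Orthogonal (classMatrix a s) (classMatrix b t)
  cases (inj₁ S≡0) _          = classMatrix-cross-orthogonal {a = a} {b} ab s t (inj₁ S≡0)
  cases (inj₂ _)   (inj₁ T≡0) = classMatrix-cross-orthogonal {a = a} {b} ab s t (inj₂ T≡0)
  -- Both matrices are the identity, contrary to the assumption that they differ.
  cases (inj₂ s≡1) (inj₂ t≡1) = contradiction
    (≈ᴹ-trans (classMatrix-identity onbᵃ s s≡1) (≈ᴹ-sym (classMatrix-identity onbᵇ t t≡1))) A≉B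

-- Closing under `≈ᴹ` gives exactly the predicate required by `HasSize`, so the inclusions there are
-- `id`.
Class : ∀ {n} → Vector (Vector ℂ n) n → Pred (Matrix n) 0ℓ
Class b A = ∃ λ t → A ≈ᴹ classMatrix b t

Class-isCommutingNormal : ∀ {n} {b : Vector (Vector ℂ n) n} → IsOrthonormalBasis b → IsCommutingNormalClass (Class b)
Class-isCommutingNormal {b = b} onb = record
  { size    = classMatrix b , injective , id , id
  ; normal  = λ { (t , A≈) i j → ≈-trans (·-cong A≈ (≈ᴹ-trans (†-cong A≈) (spectral-† (helmert t) b)) i j)
                                 (≈-sym (·-cong (≈ᴹ-trans (†-cong A≈) (spectral-† (helmert t) b)) A≈ i j)) }
  ; commute = λ { (s , A≈) (t , B≈) → ≈ᴹ-trans (·-cong A≈ B≈)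
                  (≈ᴹ-trans (spectral-comm onb (ι ∘ helmert s) (ι ∘ helmert t)) (≈ᴹ-sym (·-cong B≈ A≈))) }
  }
  where
  injective : ∀ {s t} → classMatrix b s ≈ᴹ classMatrix b t → s ≡ t
  -- Equality of indices is decidable, so refuting s ≢ t is enough: distinct indices give orthogonal
  -- matrices, and equality would make one orthogonal to itself.
  injective {s} {t} A≈B = decidable-stable (s ≟ t) λ s≢t → classMatrix-¬self-orthogonal onb s
    (Orthogonal-resp (λ _ _ → ≈-refl) (≈ᴹ-sym A≈B) (classMatrix-orthogonal onb s t s≢t))

-- A member of the first class with coefficient sum zero is orthogonal to every member of the
-- second, so belonging to both would make it self-orthogonal.
Class-≢ : ∀ {n} .{{_ : NonZero n}} {a b : Vector (Vector ℂ n) n} → IsOrthonormalBasis a → Unbiased a b →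
  ∀ s → sumℚ (helmert s) ≡ 0ℚ → ¬ (Class a ≐ Class b)
Class-≢ {a = a} {b} onbᵃ ab s S≡0 (a⊆b , _) = let t , A≈B = a⊆b (s , λ _ _ → ≈-refl) in
  classMatrix-¬self-orthogonal onbᵃ s
    (Orthogonal-resp (λ _ _ → ≈-refl) (≈ᴹ-sym A≈B)
      (classMatrix-cross-orthogonal {a = a} {b} ab s t (inj₁ S≡0)))

module _ {m n} .{{_ : NonZero n}} {B : Vector (Vector (Vector ℂ n) n) m}
  (onb : ∀ k → IsOrthonormalBasis (B k)) (unbiased : ∀ k l → k ≢ l → Unbiased (B k) (B l)) where

  classMatrices-orthogonal : ∀ {k l} → Dec (k ≡ l) → ∀ s t →
    ¬ classMatrix (B k) s ≈ᴹ classMatrix (B l) t → Orthogonal (classMatrix (B k) s) (classMatrix (B l) t)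
  classMatrices-orthogonal {k} {l} (no k≢l)     s t F≉G =
    classMatrix-cross {a = B k} {B l} (onb k) (onb l) (unbiased k l k≢l) s t F≉G
  -- Within one class, unequal matrices must have different indices.
  classMatrices-orthogonal {k} (yes ≡.refl) s t F≉G = classMatrix-orthogonal (onb k) s t λ s≡t →
    F≉G (≡.subst (λ r → classMatrix (B k) s ≈ᴹ classMatrix (B k) r) s≡t λ _ _ → ≈-refl)

  Classes-pairwiseOrthogonal : PairwiseOrthogonal (⋃ (Fin m) (Class ∘ B))
  Classes-pairwiseOrthogonal {A} {A′} (k , s , A≈) (l , t , A′≈) A≉A′ =
    Orthogonal-resp {A = classMatrix (B k) s} {A} {classMatrix (B l) t} {A′} (≈ᴹ-sym A≈) (≈ᴹ-sym A′≈)
      (classMatrices-orthogonal (k ≟ l) s t λ F≈G → A≉A′ (≈ᴹ-trans A≈ (≈ᴹ-trans F≈G (≈ᴹ-sym A′≈))))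

theorem7 : ∀ (m n : ℕ) .{{_ : NonZero n}} (B : Vector (Vector (Vector ℂ n) n) m) →
    AreMutuallyUnbiasedBases B →
    ∃ λ (C : Fin m → Pred (Matrix n) 0ℓ) →
    (∀ k → IsCommutingNormalClass (C k)) ×
    (2 ≤ n → ∀ k l → k ≢ l → ¬ (C k ≐ C l)) ×
    PairwiseOrthogonal (⋃ (Fin m) C)
theorem7 m n B (onb , unbiased) =
    Class ∘ B
  , (λ k → Class-isCommutingNormal (onb k))
  -- For n = 1 the only row is (1) and every class consists of the identity, hence the guard
  -- `2 ≤ n`.
  , (λ 2≤n k l k≢l → let s , S≡0 = sum-helmert-zero 2≤n in
      Class-≢ {a = B k} {B l} (onb k) (unbiased k l k≢l) s S≡0)
  , Classes-pairwiseOrthogonal onb unbiased
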